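{- Let $h\ge 4$ be an integer, and call a graph extremal if it is a connected graph with $\chi(G)=\Gamma(G)=3$ and $\psi(G)=h$ having the minimum possible number of vertices among all such connected graphs (this minimum is $2h-2$). Up to isomorphism, there are exactly seven extremal graphs if $h=4$, exactly three if $h=5$, and exactly two for every $h\ge 6$.
   Context: All graphs are finite, simple and undirected. A complete $k$-coloring of a graph $G=(V,E)$ is a map $\varphi:V\to\{1,\dots,k\}$, using all $k$ colors, such that adjacent vertices get different colors and for any two colors $i\neq j$ there is an edge between the color classes $i$ and $j$. $\chi(G)$ is the chromatic number; the achromatic number $\psi(G)$ is the maximum $k$ for which $G$ has a complete $k$-coloring. A Grundy coloring is a proper coloring $\varphi:V\to\{1,\dots,k\}$ such that every vertex $v$ has a neighbor of color $i$ for every $1\le i<\varphi(v)$; the Grundy number $\Gamma(G)$ is the largest $k$ for which $G$ has a Grundy coloring with $k$ colors. -}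

module Defs where

open import Data.Nat using (ℕ; _≤_; _<_; _*_; _∸_)
open import Data.Fin using (Fin; toℕ)
open import Data.Bool using (Bool; true; false)
open import Data.Product using (Σ; ∃; ∃-syntax; _×_; _,_)
open import Data.Sum using (_⊎_)
open import Data.Vec using (Vec; lookup)
open import Relation.Binary.PropositionalEquality using (_≡_; _≢_)
open import Relation.Nullary using (¬_)

record Graph : Set where
  field
    n     : ℕ
    E     : Fin n → Fin n → Bool
    sym   : ∀ u v → E u v ≡ E v u
    irrefl : ∀ v → E v v ≡ false

open Graph public

Adj : (G : Graph) → Fin (n G) → Fin (n G) → Set
Adj G u v = E G u v ≡ true

data Reach (G : Graph) : Fin (n G) → Fin (n G) → Set where
  here : ∀ {u} → Reach G u u
  step : ∀ {u v w} → Adj G u v → Reach G v w → Reach G u w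

Connected : Graph → Set
Connected G = ∀ u v → Reach G u v

-- Colorings use colors Fin k (color i ∈ Fin k stands for color i+1).
Proper : (G : Graph) {k : ℕ} → (Fin (n G) → Fin k) → Set
Proper G c = ∀ u v → Adj G u v → c u ≢ c v

Surjective : {m k : ℕ} → (Fin m → Fin k) → Set
Surjective {m} {k} c = ∀ (i : Fin k) → ∃[ v ] c v ≡ i

HasProperColoring : Graph → ℕ → Set
HasProperColoring G k = Σ (Fin (n G) → Fin k) (Proper G)

IsComplete : (G : Graph) {k : ℕ} → (Fin (n G) → Fin k) → Set
IsComplete G {k} c =
  Proper G c × Surjective c ×
  (∀ (i j : Fin k) → i ≢ j → ∃[ u ] ∃[ v ] (Adj G u v × c u ≡ i × c v ≡ j))

HasCompleteColoring : Graph → ℕ → Set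
HasCompleteColoring G k = Σ (Fin (n G) → Fin k) (IsComplete G)

IsGrundy : (G : Graph) {k : ℕ} → (Fin (n G) → Fin k) → Set
IsGrundy G {k} c =
  Proper G c × Surjective c ×
  (∀ v (i : Fin k) → toℕ i < toℕ (c v) → ∃[ u ] (Adj G v u × c u ≡ i))

HasGrundyColoring : Graph → ℕ → Set
HasGrundyColoring G k = Σ (Fin (n G) → Fin k) (IsGrundy G)

ChromaticNumber : Graph → ℕ → Set
ChromaticNumber G k = HasProperColoring G k × (∀ m → HasProperColoring G m → k ≤ m)

GrundyNumber : Graph → ℕ → Set
GrundyNumber G k = HasGrundyColoring G k × (∀ m → HasGrundyColoring G m → m ≤ k)

AchromaticNumber : Graph → ℕ → Set
AchromaticNumber G k = HasCompleteColoring G k × (∀ m → HasCompleteColoring G m → m ≤ k)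

Admissible : ℕ → Graph → Set
Admissible h G =
  Connected G × ChromaticNumber G 3 × GrundyNumber G 3 × AchromaticNumber G h

Extremal : ℕ → Graph → Set
Extremal h G = Admissible h G × (∀ H → Admissible h H → n G ≤ n H)

record _≅_ (G H : Graph) : Set where
  field
    to      : Fin (n G) → Fin (n H)
    from    : Fin (n H) → Fin (n G)
    from-to : ∀ v → from (to v) ≡ v
    to-from : ∀ w → to (from w) ≡ w
    preserve : ∀ u v → E H (to u) (to v) ≡ E G u v

ExactlyExtremalUpToIso : ℕ → ℕ → Set
ExactlyExtremalUpToIso h k =
  Σ (Vec Graph k) λ Gs →
    (∀ i → Extremal h (lookup Gs i)) ×
    (∀ i j → i ≢ j → ¬ (lookup Gs i ≅ lookup Gs j)) ×
    (∀ G → Extremal h G → ∃[ i ] (G ≅ lookup Gs i))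

{-# OPTIONS --safe #-}
module Submission where

-- Let G have a complete h-coloring and Grundy number at most 3.  Three singleton
-- colour classes would form a triangle which, with a fourth class coloured first,
-- gives a Grundy coloring with 4 colours.  So at most two classes are singletons
-- and |V| ≥ 2h - 2.  In case of equality the classes are {x}, {y} and m = h - 2 pairs
-- {a i , b i}.  Grundy number at least 4 is witnessed by a binomial tree on at
-- most 8 vertices (Atom), so the graphs induced by x, y and two or three pairs can be
-- enumerated.  This settles m = 2 and m = 3, and shows for larger m that the pairs
-- are linearly ordered by a i ~ b j ⇔ j < i, where only the first a i may see y
-- and only the last b i may see x.  Of the four resulting graphs one is bipartite
-- and two are isomorphic.

-- The finite part rests on one monotonicity: a partial Grundy coloring extends greedily to the
-- whole graph, so an atom inside any induced subgraph already forces Grundy number at least 4.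
-- Hence what `check₂` and `check₃` find for two or three pairs holds for any two or three pairs of
-- an arbitrarily large extremal graph. The counting bound also yields the upper bound on the
-- achromatic number: a complete coloring with more than h colours would need more than 2h - 2
-- vertices. For m = 3 the one graph beyond the half graphs comes from pairs whose edges to x and y
-- all end in a single vertex; from four pairs on, such a pair is incompatible with the absence of
-- atoms. The converse cannot be enumerated, since the half graphs form an infinite family. There,
-- discarding the vertices of colour 0 leaves only edges through one vertex, or a complete bipartite
-- graph, and neither has room for three further colours.

open import Defs
open import Data.Nat using (ℕ; zero; suc; _+_; _*_; _∸_; _⊔_; _≤_; _<_; z≤n; s≤s; _<ᵇ_; _≤ᵇ_; _≡ᵇ_; _≤?_)
import Data.Nat.Properties as ℕ
open import Data.Fin using (Fin; zero; suc; toℕ; fromℕ; fromℕ<; opposite; _↑ˡ_; _↑ʳ_; splitAt; join; punchIn; punchOut)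
import Data.Fin.Properties as Fin
open import Data.Fin.Permutation using (permutation)
open import Data.Bool using (Bool; true; false; not; _∧_; _∨_; if_then_else_; T)
open import Data.Product using (Σ; ∃-syntax; _×_; _,_; proj₁; proj₂)
open import Data.Sum using (_⊎_; inj₁; inj₂)
open import Data.Empty using (⊥)
open import Data.List using (List; []; _∷_; allFin)
open import Data.List.Membership.Propositional using (_∈_)
open import Data.List.Membership.Propositional.Properties using (∈-allFin)
open import Data.List.Relation.Unary.Any using (here; there)
open import Data.Vec using (Vec; []; _∷_; lookup; tabulate)
open import Data.Vec.Properties using (lookup∘tabulate)
open import Function using (_∘_; id)
open import Relation.Nullary using (¬_; Dec; yes; no; contradiction)
open import Relation.Nullary.Decidable using (_×-dec_; ¬?)
open import Relation.Unary using (Decidable)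
open import Relation.Binary.Definitions using (tri<; tri≈; tri>)
open import Relation.Binary.PropositionalEquality
  using (_≡_; _≢_; refl; cong; cong₂; trans; subst; subst₂)
  renaming (sym to ≡-sym)
import Algebra.Properties.CommutativeMonoid.Sum ℕ.+-0-commutativeMonoid as Sum

-- Finite preliminaries

true≢false : ∀ {β} → β ≡ true → β ≢ false
true≢false refl ()

≢true⇒false : ∀ {β} → β ≢ true → β ≡ false
≢true⇒false {true}  β≢ = contradiction refl β≢
≢true⇒false {false} _  = refl

≢false⇒true : ∀ {β} → β ≢ false → β ≡ true
≢false⇒true {true}  _  = refl
≢false⇒true {false} β≢ = contradiction refl β≢

∧-elim : ∀ {β γ} → β ∧ γ ≡ true → β ≡ true × γ ≡ true
∧-elim {true} eq = refl , eq

∧-intro : ∀ {β γ} → β ≡ true → γ ≡ true → β ∧ γ ≡ true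
∧-intro refl eq = eq

∨-elim : ∀ {β γ} → β ∨ γ ≡ true → β ≡ true ⊎ γ ≡ true
∨-elim {true}  _  = inj₁ refl
∨-elim {false} eq = inj₂ eq

∨-introˡ : ∀ {β γ} → β ≡ true → β ∨ γ ≡ true
∨-introˡ refl = refl

∨-introʳ : ∀ {β γ} → γ ≡ true → β ∨ γ ≡ true
∨-introʳ {true}  _  = refl
∨-introʳ {false} eq = eq

not-true : ∀ {β} → not β ≡ true → β ≡ false
not-true {false} _ = refl

not-false : ∀ {β} → β ≡ false → not β ≡ true
not-false refl = refl

infixr 4 _⇒_
_⇒_ : Bool → Bool → Bool
β ⇒ γ = not β ∨ γ

⇒-elim : ∀ {β γ} → (β ⇒ γ) ≡ true → β ≡ true → γ ≡ true
⇒-elim eq refl = eq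

infix 5 _==_
_==_ : Bool → Bool → Bool
true  == γ = γ
false == γ = not γ

==-sound : ∀ {β γ} → (β == γ) ≡ true → β ≡ γ
==-sound {true}  eq = ≡-sym eq
==-sound {false} eq = ≡-sym (not-true eq)

leastℕ : ∀ {P : ℕ → Set} → Decidable P → ∀ k → P k →
         ∃[ l ] P l × (∀ j → j < l → ¬ P j)
leastℕ {P} P? zero    p = zero , p , λ _ ()
leastℕ {P} P? (suc k) p with P? zero
... | yes p₀ = zero , p₀ , λ _ ()
... | no ¬p₀ with leastℕ (P? ∘ suc) k p
...   | l , pl , min = suc l , pl , λ where
        zero    _         p₀ → ¬p₀ p₀
        (suc j) (s≤s j<l) pj → min j j<l pj

maximiser : ∀ {k} (f : Fin k → ℕ) → Fin k → ∃[ i ] ∀ j → f j ≤ f i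
maximiser {suc zero}    f _ = zero , λ { zero → ℕ.≤-refl }
maximiser {suc (suc k)} f _ with maximiser (f ∘ suc) zero
... | i , i-max with ℕ.≤-total (f zero) (f (suc i))
...   | inj₁ ≤i = suc i , λ { zero → ≤i ; (suc j) → i-max j }
...   | inj₂ i≤ = zero , λ { zero → ℕ.≤-refl ; (suc j) → ℕ.≤-trans (i-max j) i≤ }

missed-value : ∀ {k l} → k < l → (f : Fin k → Fin l) → ∃[ i ] ∀ j → f j ≢ i
missed-value {k} {l} k<l f with Fin.any? (λ i → Fin.all? (λ j → ¬? (f j Fin.≟ i)))
... | yes found = found
... | no  none  = contradiction (Fin.injective⇒≤ g-injective) (ℕ.<⇒≱ k<l)
  where
  preimage : ∀ i → ∃[ j ] f j ≡ i
  preimage i with Fin.any? (λ j → f j Fin.≟ i)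
  ... | yes hit = hit
  ... | no  miss = contradiction (i , λ j eq → miss (j , eq)) none
  g-injective : ∀ {i i′} → proj₁ (preimage i) ≡ proj₁ (preimage i′) → i ≡ i′
  g-injective {i} {i′} eq =
    trans (≡-sym (proj₂ (preimage i))) (trans (cong f eq) (proj₂ (preimage i′)))

injective⇒surjective : ∀ {k} (f : Fin k → Fin k) → (∀ {i j} → f i ≡ f j → i ≡ j) →
                       ∀ i → ∃[ j ] f j ≡ i
injective⇒surjective f f-inj i with Fin.any? (λ j → f j Fin.≟ i)
... | yes hit = hit
... | no miss = contradiction (Fin.injective⇒≤ g-injective) ℕ.1+n≰n
  where
  g : Fin (suc _) → Fin _
  g zero    = i
  g (suc j) = f j
  g-injective : ∀ {j j′} → g j ≡ g j′ → j ≡ j′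
  g-injective {zero}  {zero}   _  = refl
  g-injective {zero}  {suc j′} eq = contradiction (j′ , ≡-sym eq) miss
  g-injective {suc j} {zero}   eq = contradiction (j , eq) miss
  g-injective {suc j} {suc j′} eq = cong suc (f-inj eq)

-- A tree witnessing Grundy number at least 4: r has colour 3, u₂ colour 2,
-- u₁ and w₁ colour 1, the others colour 0.  Vertices of different colours are
-- automatically distinct, since only the larger colour sees the smaller one;
-- vertices of the same colour may coincide.
record Atom {A : Set} (M : A → A → Bool) : Set where
  field
    r u₂ u₁ w₁ u₀ w₀ z t : A
    r~u₂  : M r u₂ ≡ true
    r~u₁  : M r u₁ ≡ true
    u₂~w₁ : M u₂ w₁ ≡ true
    r~u₀  : M r u₀ ≡ true
    u₂~w₀ : M u₂ w₀ ≡ true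
    u₁~z  : M u₁ z ≡ true
    w₁~t  : M w₁ t ≡ true
    u₁≁w₁ : M u₁ w₁ ≡ false
    u₀≁w₀ : M u₀ w₀ ≡ false
    u₀≁z  : M u₀ z ≡ false
    u₀≁t  : M u₀ t ≡ false
    w₀≁z  : M w₀ z ≡ false
    w₀≁t  : M w₀ t ≡ false
    z≁t   : M z t ≡ false

-- Greedy extension of partial Grundy colorings

module Greedy (G : Graph) where

  V : Set
  V = Fin (n G)

  -- A partial Grundy coloring, listed as (vertex , colour) pairs.
  record Partial (s : List (V × ℕ)) : Set where
    field
      independent : ∀ {v w i} → (v , i) ∈ s → (w , i) ∈ s → E G v w ≡ false
      dominated   : ∀ {v j} → (v , j) ∈ s → ∀ i → i < j → ∃[ w ] (w , i) ∈ s × Adj G v w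
  open Partial

  flip-false : ∀ {v w} → E G v w ≡ false → E G w v ≡ false
  flip-false {v} {w} = trans (sym G w v)

  empty : Partial []
  empty = record { independent = λ () ; dominated = λ () }

  add : ∀ {s} → Partial s → ∀ v i →
        (∀ {w} → (w , i) ∈ s → E G v w ≡ false) →
        (∀ j → j < i → ∃[ w ] (w , j) ∈ s × Adj G v w) →
        Partial ((v , i) ∷ s)
  add P v i ind dom = record
    { independent = λ where
        (here refl) (here refl) → irrefl G v
        (here refl) (there w∈)  → ind w∈
        (there v∈)  (here refl) → flip-false (ind v∈)
        (there v∈)  (there w∈)  → independent P v∈ w∈
    ; dominated = λ where
        (here refl) j j<i → let w , w∈ , v~w = dom j j<i in w , there w∈ , v~w
        (there v∈)  j j<i → let w , w∈ , v~w = dominated P v∈ j j<i in w , there w∈ , v~w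
    }

  -- If `v` carried colours i < j, its entry of colour j would see a vertex of colour i, against the
  -- independence of that class. So entries may repeat and no freshness has to be tracked, which
  -- lets vertices of an atom coincide.
  unique-colour : ∀ {s} → Partial s → ∀ {v i j} → (v , i) ∈ s → (v , j) ∈ s → i ≡ j
  unique-colour P {v} {i} {j} vi vj with ℕ.<-cmp i j
  ... | tri≈ _ i≡j _ = i≡j
  ... | tri< i<j _ _ = let w , w∈ , v~w = dominated P vj i i<j in
                         contradiction (independent P vi w∈) (true≢false v~w)
  ... | tri> _ _ j<i = let w , w∈ , v~w = dominated P vi j j<i in
                         contradiction (independent P vj w∈) (true≢false v~w)

  Coloured : List (V × ℕ) → V → Set
  Coloured s v = ∃[ i ] (v , i) ∈ s

  coloured? : ∀ s → Decidable (Coloured s)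
  coloured? []            v = no λ ()
  coloured? ((w , i) ∷ s) v with v Fin.≟ w
  ... | yes refl = yes (i , here refl)
  ... | no v≢w with coloured? s v
  ...   | yes (j , v∈) = yes (j , there v∈)
  ...   | no v∉ = no λ { (j , here refl) → v≢w refl ; (j , there v∈) → v∉ (j , v∈) }

  Sees : List (V × ℕ) → V → ℕ → Set
  Sees s v i = ∃[ w ] (w , i) ∈ s × Adj G v w

  sees? : ∀ s v → Decidable (Sees s v)
  sees? [] v i = no λ ()
  sees? ((w , j) ∷ s) v i with sees? s v i
  ... | yes (w′ , w∈ , v~w) = yes (w′ , there w∈ , v~w)
  ... | no unseen with i ℕ.≟ j | E G v w in eq
  ...   | yes refl | true  = yes (w , here refl , eq)
  ...   | yes refl | false = no λ where
            (_  , here refl , v~w) → true≢false v~w eq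
            (w′ , there w∈  , v~w) → unseen (w′ , w∈ , v~w)
  ...   | no i≢j   | _     = no λ where
            (_  , here refl , _)   → i≢j refl
            (w′ , there w∈  , v~w) → unseen (w′ , w∈ , v~w)

  unused-colour : ∀ s → ∃[ k ] (∀ {v : V} {i} → (v , i) ∈ s → i < k)
  unused-colour []            = 0 , λ ()
  unused-colour ((w , j) ∷ s) with unused-colour s
  ... | k , s<k = suc j ⊔ k , λ where
        (here refl) → ℕ.m≤m⊔n (suc j) k
        (there v∈)  → ℕ.≤-trans (s<k v∈) (ℕ.m≤n⊔m (suc j) k)

  _⊆ˢ_ : List (V × ℕ) → List (V × ℕ) → Set
  s ⊆ˢ s′ = ∀ {e} → e ∈ s → e ∈ s′

  -- The least colour that `v` does not see can be given to it: domination is the minimality, and a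
  -- colour above all used ones shows that an unseen colour exists.
  colour-vertex : ∀ {s} → Partial s → ∀ v → ∃[ s′ ] Partial s′ × s ⊆ˢ s′ × Coloured s′ v
  colour-vertex {s} P v with coloured? s v
  ... | yes cv = s , P , id , cv
  ... | no _ with leastℕ (λ i → ¬? (sees? s v i)) (proj₁ (unused-colour s))
                    (λ { (w , w∈ , _) → ℕ.<-irrefl refl (proj₂ (unused-colour s) w∈) })
  ...   | i , unseen , below = (v , i) ∷ s , add P v i ind dom , there , i , here refl
    where
    ind : ∀ {w} → (w , i) ∈ s → E G v w ≡ false
    ind w∈ = ≢true⇒false λ v~w → unseen (_ , w∈ , v~w)
    dom : ∀ j → j < i → Sees s v j
    dom j j<i with sees? s v j
    ... | yes seen = seen
    ... | no ¬seen = contradiction ¬seen (below j j<i)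

  colour-list : ∀ {s} → Partial s → ∀ vs →
                ∃[ s′ ] Partial s′ × s ⊆ˢ s′ × (∀ {v} → v ∈ vs → Coloured s′ v)
  colour-list P []       = _ , P , id , λ ()
  colour-list P (v ∷ vs) with colour-list P vs
  ... | s₁ , P₁ , ⊆₁ , done₁ with colour-vertex P₁ v
  ...   | s₂ , P₂ , ⊆₂ , i , vi = s₂ , P₂ , ⊆₂ ∘ ⊆₁ , λ where
          (here refl) → i , vi
          (there v∈)  → let j , vj = done₁ v∈ in j , ⊆₂ vj

  -- Greedy completion never recolours, so `v` keeps colour i, and the number of colours, one more
  -- than the largest colour, exceeds i.
  partial⇒grundy : ∀ {s} → Partial s → ∀ {v i} → (v , i) ∈ s →
                   ∃[ k ] i < k × HasGrundyColoring G k
  partial⇒grundy P {r} {i} ri with colour-list P (allFin (n G))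
  ... | s , Q , ⊆ , done = suc top , i<k , c , c-proper , c-surjective , c-dominated
    where
    col : V → ℕ
    col v = proj₁ (done (∈-allFin v))
    col∈ : ∀ v → (v , col v) ∈ s
    col∈ v = proj₂ (done (∈-allFin v))
    highest : V
    highest = proj₁ (maximiser col r)
    top : ℕ
    top = col highest
    col≤ : ∀ v → col v < suc top
    col≤ v = s≤s (proj₂ (maximiser col r) v)
    i<k : i < suc top
    i<k = subst (_< suc top) (unique-colour Q (col∈ r) (⊆ ri)) (col≤ r)
    c : V → Fin (suc top)
    c v = fromℕ< (col≤ v)
    toℕ-c : ∀ v → toℕ (c v) ≡ col v
    toℕ-c v = Fin.toℕ-fromℕ< (col≤ v)
    c-proper : Proper G c
    c-proper u v u~v eq = true≢false u~v (independent Q (col∈ u)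
      (subst (λ j → (v , j) ∈ s) (trans (≡-sym (toℕ-c v)) (trans (cong toℕ (≡-sym eq)) (toℕ-c u))) (col∈ v)))
    c-≡ : ∀ {v} j → (v , toℕ j) ∈ s → c v ≡ j
    c-≡ {v} j v∈ = Fin.toℕ-injective (trans (toℕ-c v) (unique-colour Q (col∈ v) v∈))
    c-dominated : ∀ v (j : Fin (suc top)) → toℕ j < toℕ (c v) → ∃[ u ] (Adj G v u × c u ≡ j)
    c-dominated v j j<c =
      let u , u∈ , v~u = dominated Q (col∈ v) (toℕ j) (subst (toℕ j <_) (toℕ-c v) j<c)
      in u , v~u , c-≡ j u∈
    c-surjective : Surjective c
    c-surjective j with ℕ.m≤n⇒m<n∨m≡n (ℕ.≤-pred (Fin.toℕ<n j))
    -- A vertex of the largest colour sees every smaller colour, so the coloring is onto.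
    ... | inj₁ j<top = let u , _ , eq = c-dominated highest j (subst (toℕ j <_) (≡-sym (toℕ-c highest)) j<top)
                       in u , eq
    ... | inj₂ j≡top = highest , Fin.toℕ-injective (trans (toℕ-c highest) (≡-sym j≡top))

  -- Entries are added by increasing colour, so each one is dominated by entries already present.
  -- The absurd patterns express that earlier entries have other colours.
  atom⇒grundy : Atom (E G) → ∃[ k ] 3 < k × HasGrundyColoring G k
  atom⇒grundy A = partial⇒grundy
      (add (add (add (add (add (add (add (add empty
        t 0 (λ ()) λ _ ())
        z 0 (λ { (here refl) → z≁t }) λ _ ())
        w₀ 0 (λ { (here refl) → w₀≁z ; (there (here refl)) → w₀≁t }) λ _ ())
        u₀ 0 (λ { (here refl) → u₀≁w₀ ; (there (here refl)) → u₀≁z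
                ; (there (there (here refl))) → u₀≁t }) λ _ ())
        w₁ 1 (λ { (there (there (there (there ())))) })
             λ { zero _ → t , there (there (there (here refl))) , w₁~t ; (suc _) (s≤s ()) })
        u₁ 1 (λ { (here refl) → u₁≁w₁ ; (there (there (there (there (there ()))))) })
             λ { zero _ → z , there (there (there (here refl))) , u₁~z ; (suc _) (s≤s ()) })
        u₂ 2 (λ { (there (there (there (there (there (there ())))))) })
             λ { zero _ → w₀ , there (there (there (here refl))) , u₂~w₀
               ; (suc zero) _ → w₁ , there (here refl) , u₂~w₁
               ; (suc (suc _)) (s≤s (s≤s ())) })
        r 3 (λ { (there (there (there (there (there (there (there ()))))))) })
            λ { zero _ → u₀ , there (there (there (here refl))) , r~u₀
              ; (suc zero) _ → u₁ , there (here refl) , r~u₁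
              ; (suc (suc zero)) _ → u₂ , here refl , r~u₂
              ; (suc (suc (suc _))) (s≤s (s≤s (s≤s ()))) })
      (here refl)
    where open Atom A

  triangle⇒grundy : ∀ {u v w} → Adj G u v → Adj G u w → Adj G v w →
                    ∃[ k ] 2 < k × HasGrundyColoring G k
  triangle⇒grundy {u} {v} {w} u~v u~w v~w = partial⇒grundy
      (add (add (add empty
        w 0 (λ ()) λ _ ())
        v 1 (λ { (there ()) }) λ { zero _ → w , here refl , v~w ; (suc _) (s≤s ()) })
        u 2 (λ { (there (there ())) })
          λ { zero _ → w , there (here refl) , u~w
            ; (suc zero) _ → v , here refl , u~v
            ; (suc (suc _)) (s≤s (s≤s ())) })
      (here refl)

  -- Surjectivity provides a vertex of colour 3; descending through neighbours of smaller colours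
  -- unfolds the binomial tree.
  grundy⇒atom : ∀ {k} → 3 < k → HasGrundyColoring G k → Atom (E G)
  grundy⇒atom (s≤s (s≤s (s≤s (s≤s {n = k} _)))) (c , proper , surj , dom) = record
      { r~u₂ = proj₁ (proj₂ U₂) ; r~u₁ = proj₁ (proj₂ U₁) ; u₂~w₁ = proj₁ (proj₂ W₁)
      ; r~u₀ = proj₁ (proj₂ U₀) ; u₂~w₀ = proj₁ (proj₂ W₀) ; u₁~z = proj₁ (proj₂ Z₀)
      ; w₁~t = proj₁ (proj₂ T₀)
      ; u₁≁w₁ = same (proj₂ (proj₂ U₁)) (proj₂ (proj₂ W₁))
      ; u₀≁w₀ = same (proj₂ (proj₂ U₀)) (proj₂ (proj₂ W₀))
      ; u₀≁z  = same (proj₂ (proj₂ U₀)) (proj₂ (proj₂ Z₀))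
      ; u₀≁t  = same (proj₂ (proj₂ U₀)) (proj₂ (proj₂ T₀))
      ; w₀≁z  = same (proj₂ (proj₂ W₀)) (proj₂ (proj₂ Z₀))
      ; w₀≁t  = same (proj₂ (proj₂ W₀)) (proj₂ (proj₂ T₀))
      ; z≁t   = same (proj₂ (proj₂ Z₀)) (proj₂ (proj₂ T₀)) }
    where
    same : ∀ {u v i} → c u ≡ i → c v ≡ i → E G u v ≡ false
    same cu cv = ≢true⇒false λ u~v → proper _ _ u~v (trans cu (≡-sym cv))
    child : ∀ {v j} → c v ≡ j → (i : Fin (4 + k)) → toℕ i < toℕ j → ∃[ u ] (Adj G v u × c u ≡ i)
    child {v} cv i i<j = dom v i (subst (λ j → toℕ i < toℕ j) (≡-sym cv) i<j)
    R = surj (suc (suc (suc zero)))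
    U₂ = child (proj₂ R) (suc (suc zero)) (s≤s (s≤s (s≤s z≤n)))
    U₁ = child (proj₂ R) (suc zero) (s≤s (s≤s z≤n))
    U₀ = child (proj₂ R) zero (s≤s z≤n)
    W₁ = child (proj₂ (proj₂ U₂)) (suc zero) (s≤s (s≤s z≤n))
    W₀ = child (proj₂ (proj₂ U₂)) zero (s≤s z≤n)
    Z₀ = child (proj₂ (proj₂ U₁)) zero (s≤s z≤n)
    T₀ = child (proj₂ (proj₂ W₁)) zero (s≤s z≤n)

-- An atom mentions adjacencies and non-adjacencies but no equalities of vertices, so it travels
-- along every map that respects both.
atom-pullback : ∀ {A B : Set} {M : A → A → Bool} {N : B → B → Bool} (f : A → B) →
                (∀ u v → N (f u) (f v) ≡ M u v) → Atom M → Atom N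
atom-pullback {M = M} {N} f eq A = record
  { r~u₂ = pull r~u₂ ; r~u₁ = pull r~u₁ ; u₂~w₁ = pull u₂~w₁ ; r~u₀ = pull r~u₀
  ; u₂~w₀ = pull u₂~w₀ ; u₁~z = pull u₁~z ; w₁~t = pull w₁~t
  ; u₁≁w₁ = pull u₁≁w₁ ; u₀≁w₀ = pull u₀≁w₀ ; u₀≁z = pull u₀≁z ; u₀≁t = pull u₀≁t
  ; w₀≁z = pull w₀≁z ; w₀≁t = pull w₀≁t ; z≁t = pull z≁t }
  where
  open Atom A
  pull : ∀ {u v β} → M u v ≡ β → N (f u) (f v) ≡ β
  pull {u} {v} eq′ = trans (eq u v) eq′

-- Labelled graphs and the exhaustive checks

data Lab (m : ℕ) : Set where
  x y : Lab m
  a b : Fin m → Lab m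

-- Opaque, so that unification does not unfold nested searches.
opaque
  allᵇ : ∀ {k} → (Fin k → Bool) → Bool
  allᵇ {zero}  f = true
  allᵇ {suc k} f = f zero ∧ allᵇ (f ∘ suc)

  allᵇ-sound : ∀ {k} {f : Fin k → Bool} → allᵇ f ≡ true → ∀ i → f i ≡ true
  allᵇ-sound eq zero    = proj₁ (∧-elim eq)
  allᵇ-sound eq (suc i) = allᵇ-sound (proj₂ (∧-elim eq)) i

  anyᵇ : ∀ {k} → (Fin k → Bool) → Bool
  anyᵇ {zero}  f = false
  anyᵇ {suc k} f = f zero ∨ anyᵇ (f ∘ suc)

  anyᵇ-sound : ∀ {k} {f : Fin k → Bool} → anyᵇ f ≡ true → ∃[ i ] f i ≡ true
  anyᵇ-sound {suc k} eq with ∨-elim eq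
  ... | inj₁ eq₀ = zero , eq₀
  ... | inj₂ eq₊ = let i , eqᵢ = anyᵇ-sound eq₊ in suc i , eqᵢ

  anyᵇ-complete : ∀ {k} {f : Fin k → Bool} i → f i ≡ true → anyᵇ f ≡ true
  anyᵇ-complete zero    eq = ∨-introˡ eq
  anyᵇ-complete (suc i) eq = ∨-introʳ (anyᵇ-complete i eq)

  allᵇ-complete : ∀ {k} {f : Fin k → Bool} → (∀ i → f i ≡ true) → allᵇ f ≡ true
  allᵇ-complete {zero}  eq = refl
  allᵇ-complete {suc k} eq = ∧-intro (eq zero) (allᵇ-complete (eq ∘ suc))

  allBits : ∀ k → (Vec Bool k → Bool) → Bool
  allBits zero    f = f []
  allBits (suc k) f = allBits k (f ∘ (true ∷_)) ∧ allBits k (f ∘ (false ∷_))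

  allBits-sound : ∀ k {f} → allBits k f ≡ true → ∀ v → f v ≡ true
  allBits-sound zero    eq []          = eq
  allBits-sound (suc k) eq (true ∷ v)  = allBits-sound k (proj₁ (∧-elim eq)) v
  allBits-sound (suc k) eq (false ∷ v) = allBits-sound k (proj₂ (∧-elim eq)) v

  anyBits : ∀ k → (Vec Bool k → Bool) → Bool
  anyBits zero    f = f []
  anyBits (suc k) f = anyBits k (f ∘ (true ∷_)) ∨ anyBits k (f ∘ (false ∷_))

  anyBits-sound : ∀ k {f} → anyBits k f ≡ true → ∃[ v ] f v ≡ true
  anyBits-sound zero    eq = [] , eq
  anyBits-sound (suc k) eq with ∨-elim eq
  ... | inj₁ eqₜ = let v , eqᵥ = anyBits-sound k eqₜ in true ∷ v , eqᵥ
  ... | inj₂ eqf = let v , eqᵥ = anyBits-sound k eqf in false ∷ v , eqᵥ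

  allLab : ∀ {m} → (Lab m → Bool) → Bool
  allLab f = f x ∧ f y ∧ allᵇ (f ∘ a) ∧ allᵇ (f ∘ b)

  allLab-sound : ∀ {m} {f : Lab m → Bool} → allLab f ≡ true → ∀ v → f v ≡ true
  allLab-sound {f = f} eq with ∧-elim {f x} eq
  ... | eqx , eq′ with ∧-elim {f y} eq′
  ... | eqy , eq″ with ∧-elim {allᵇ (f ∘ a)} eq″
  ... | eqa , eqb = λ where
    x     → eqx
    y     → eqy
    (a i) → allᵇ-sound eqa i
    (b i) → allᵇ-sound eqb i

  anyLab : ∀ {m} → (Lab m → Bool) → Bool
  anyLab f = f x ∨ f y ∨ anyᵇ (f ∘ a) ∨ anyᵇ (f ∘ b)

  anyLab-sound : ∀ {m} {f : Lab m → Bool} → anyLab f ≡ true → ∃[ v ] f v ≡ true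
  anyLab-sound {f = f} eq with ∨-elim {f x} eq
  ... | inj₁ eqx = x , eqx
  ... | inj₂ eq′ with ∨-elim {f y} eq′
  ... | inj₁ eqy = y , eqy
  ... | inj₂ eq″ with ∨-elim {anyᵇ (f ∘ a)} eq″
  ... | inj₁ eqa = let i , eqᵢ = anyᵇ-sound eqa in a i , eqᵢ
  ... | inj₂ eqb = let i , eqᵢ = anyᵇ-sound eqb in b i , eqᵢ

  anyLab-complete : ∀ {m} {f : Lab m → Bool} v → f v ≡ true → anyLab f ≡ true
  anyLab-complete x eq = ∨-introˡ eq
  anyLab-complete {f = f} y eq = ∨-introʳ {f x} (∨-introˡ eq)
  anyLab-complete {f = f} (a i) eq = ∨-introʳ {f x} (∨-introʳ {f y} (∨-introˡ (anyᵇ-complete i eq)))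
  anyLab-complete {f = f} (b i) eq =
    ∨-introʳ {f x} (∨-introʳ {f y} (∨-introʳ {anyᵇ (f ∘ a)} (anyᵇ-complete i eq)))

module _ {m} (M : Lab m → Lab m → Bool) where

  _~_ _≁_ : Lab m → Lab m → Bool
  u ~ v = M u v
  u ≁ v = not (M u v)

  -- Each test stands right after the choice of its last vertex, which prunes the search during
  -- evaluation.
  hasAtom : Bool
  hasAtom =
    anyLab λ r → anyLab λ u₂ → r ~ u₂ ∧
    anyLab λ u₁ → r ~ u₁ ∧ anyLab λ w₁ → u₂ ~ w₁ ∧ u₁ ≁ w₁ ∧
    anyLab λ z → u₁ ~ z ∧ anyLab λ t → w₁ ~ t ∧ z ≁ t ∧
    anyLab λ u₀ → r ~ u₀ ∧ u₀ ≁ z ∧ u₀ ≁ t ∧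
    anyLab λ w₀ → u₂ ~ w₀ ∧ u₀ ≁ w₀ ∧ w₀ ≁ z ∧ w₀ ≁ t

  atom⇒hasAtom : Atom M → hasAtom ≡ true
  atom⇒hasAtom A =
    anyLab-complete r (anyLab-complete u₂ (∧-intro r~u₂
    (anyLab-complete u₁ (∧-intro r~u₁ (anyLab-complete w₁ (∧-intro u₂~w₁ (∧-intro (not-false u₁≁w₁)
    (anyLab-complete z (∧-intro u₁~z (anyLab-complete t (∧-intro w₁~t (∧-intro (not-false z≁t)
    (anyLab-complete u₀ (∧-intro r~u₀ (∧-intro (not-false u₀≁z) (∧-intro (not-false u₀≁t)
    (anyLab-complete w₀ (∧-intro u₂~w₀ (∧-intro (not-false u₀≁w₀)
      (∧-intro (not-false w₀≁z) (not-false w₀≁t)))))))))))))))))))))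
    where open Atom A

  hasAtom⇒atom : hasAtom ≡ true → Atom M
  hasAtom⇒atom eq with anyLab-sound eq
  ... | r , eq with anyLab-sound eq
  ... | u₂ , eq with ∧-elim {r ~ u₂} eq
  ... | r~u₂ , eq with anyLab-sound eq
  ... | u₁ , eq with ∧-elim {r ~ u₁} eq
  ... | r~u₁ , eq with anyLab-sound eq
  ... | w₁ , eq with ∧-elim {u₂ ~ w₁} eq
  ... | u₂~w₁ , eq with ∧-elim {u₁ ≁ w₁} eq
  ... | u₁≁w₁ , eq with anyLab-sound eq
  ... | z , eq with ∧-elim {u₁ ~ z} eq
  ... | u₁~z , eq with anyLab-sound eq
  ... | t , eq with ∧-elim {w₁ ~ t} eq
  ... | w₁~t , eq with ∧-elim {z ≁ t} eq
  ... | z≁t , eq with anyLab-sound eq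
  ... | u₀ , eq with ∧-elim {r ~ u₀} eq
  ... | r~u₀ , eq with ∧-elim {u₀ ≁ z} eq
  ... | u₀≁z , eq with ∧-elim {u₀ ≁ t} eq
  ... | u₀≁t , eq with anyLab-sound eq
  ... | w₀ , eq with ∧-elim {u₂ ~ w₀} eq
  ... | u₂~w₀ , eq with ∧-elim {u₀ ≁ w₀} eq
  ... | u₀≁w₀ , eq with ∧-elim {w₀ ≁ z} eq
  ... | w₀≁z , w₀≁t = record
    { r~u₂ = r~u₂ ; r~u₁ = r~u₁ ; u₂~w₁ = u₂~w₁ ; r~u₀ = r~u₀ ; u₂~w₀ = u₂~w₀ ; u₁~z = u₁~z
    ; w₁~t = w₁~t ; u₁≁w₁ = not-true u₁≁w₁ ; u₀≁w₀ = not-true u₀≁w₀ ; u₀≁z = not-true u₀≁z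
    ; u₀≁t = not-true u₀≁t ; w₀≁z = not-true w₀≁z ; w₀≁t = not-true w₀≁t ; z≁t = not-true z≁t }

-- Encoding of pairs and the finite enumeration

Kind Cross : Set
Kind  = Vec Bool 3
Cross = Vec Bool 4

pattern kind x~b y~a y~b = x~b ∷ y~a ∷ y~b ∷ []
pattern cross aa ab ba bb = aa ∷ ab ∷ ba ∷ bb ∷ []

flipped : Cross → Cross
flipped (cross aa ab ba bb) = cross aa ba ab bb

-- Normalised so that x is adjacent to every a i.
model : ∀ {m} → (Fin m → Kind) → (Fin m → Fin m → Cross) → Lab m → Lab m → Bool
model K C x     x     = false
model K C x     y     = true
model K C x     (a i) = true
model K C x     (b i) with kind x~b _ _ ← K i = x~b
model K C y     x     = true
model K C y     y     = false
model K C y     (a i) with kind _ y~a _ ← K i = y~a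
model K C y     (b i) with kind _ _ y~b ← K i = y~b
model K C (a i) x     = true
model K C (a i) y     with kind _ y~a _ ← K i = y~a
model K C (a i) (a j) with cross aa _ _ _ ← C i j = aa
model K C (a i) (b j) with cross _ ab _ _ ← C i j = ab
model K C (b i) x     with kind x~b _ _ ← K i = x~b
model K C (b i) y     with kind _ _ y~b ← K i = y~b
model K C (b i) (a j) with cross _ _ ba _ ← C i j = ba
model K C (b i) (b j) with cross _ _ _ bb ← C i j = bb

no-cross : Cross
no-cross = cross false false false false

kinds₂ : Kind → Kind → Fin 2 → Kind
kinds₂ k₀ k₁ zero       = k₀
kinds₂ k₀ k₁ (suc zero) = k₁

crosses₂ : Cross → Fin 2 → Fin 2 → Cross
crosses₂ c zero       zero       = no-cross
crosses₂ c zero       (suc zero) = c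
crosses₂ c (suc zero) zero       = flipped c
crosses₂ c (suc zero) (suc zero) = no-cross

model₂ : Kind → Kind → Cross → Lab 2 → Lab 2 → Bool
model₂ k₀ k₁ c = model (kinds₂ k₀ k₁) (crosses₂ c)

kinds₃ : Kind → Kind → Kind → Fin 3 → Kind
kinds₃ k₀ k₁ k₂ zero             = k₀
kinds₃ k₀ k₁ k₂ (suc zero)       = k₁
kinds₃ k₀ k₁ k₂ (suc (suc zero)) = k₂

crosses₃ : Cross → Cross → Cross → Fin 3 → Fin 3 → Cross
crosses₃ c₀₁ c₀₂ c₁₂ zero             zero             = no-cross
crosses₃ c₀₁ c₀₂ c₁₂ zero             (suc zero)       = c₀₁
crosses₃ c₀₁ c₀₂ c₁₂ zero             (suc (suc zero)) = c₀₂
crosses₃ c₀₁ c₀₂ c₁₂ (suc zero)       zero             = flipped c₀₁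
crosses₃ c₀₁ c₀₂ c₁₂ (suc zero)       (suc zero)       = no-cross
crosses₃ c₀₁ c₀₂ c₁₂ (suc zero)       (suc (suc zero)) = c₁₂
crosses₃ c₀₁ c₀₂ c₁₂ (suc (suc zero)) zero             = flipped c₀₂
crosses₃ c₀₁ c₀₂ c₁₂ (suc (suc zero)) (suc zero)       = flipped c₁₂
crosses₃ c₀₁ c₀₂ c₁₂ (suc (suc zero)) (suc (suc zero)) = no-cross

model₃ : Kind → Kind → Kind → Cross → Cross → Cross → Lab 3 → Lab 3 → Bool
model₃ k₀ k₁ k₂ c₀₁ c₀₂ c₁₂ = model (kinds₃ k₀ k₁ k₂) (crosses₃ c₀₁ c₀₂ c₁₂)

-- To be read together with x ~ a. If x and y can see different vertices of the pair, these are
-- called a and b; otherwise a is the only vertex of the pair that either of them sees.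
normal : Kind → Bool
normal (kind x~b y~a y~b) = y~b ∨ (y~a ∧ not x~b)

joined : Cross → Bool
joined (cross aa ab ba bb) = aa ∨ ab ∨ ba ∨ bb

exactlyOne : Cross → Bool
exactlyOne (cross true  false false false) = true
exactlyOne (cross false true  false false) = true
exactlyOne (cross false false true  false) = true
exactlyOne (cross false false false true ) = true
exactlyOne _                               = false

-- Two pairs are joined by a single edge, and this edge avoids the common
-- neighbours of x and y.
compatible : Kind → Kind → Cross → Bool
compatible (kind x~b y~a y~b) (kind x~b′ y~a′ y~b′) c@(cross aa ab ba bb) =
  exactlyOne c ∧ (aa ∨ ab ⇒ not y~a) ∧ (ba ∨ bb ⇒ not (x~b ∧ y~b)) ∧
  (aa ∨ ba ⇒ not y~a′) ∧ (ab ∨ bb ⇒ not (x~b′ ∧ y~b′))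

same : ∀ {m} (M N : Lab m → Lab m → Bool) → Bool
same M N = allLab λ u → allLab λ v → M u v == N u v

same-sound : ∀ {m} {M N : Lab m → Lab m → Bool} → same M N ≡ true → ∀ u v → M u v ≡ N u v
same-sound eq u v = ==-sound (allLab-sound (allLab-sound eq u) v)

onB : ∀ {m} → Lab m → Bool
onB (b _) = true
onB _     = false

xSide : ∀ {m} → Lab m → Bool
xSide x     = true
xSide y     = false
xSide (a _) = false
xSide (b _) = true

-- The b's are then a union of connected components.
detached : ∀ {m} → (Lab m → Lab m → Bool) → Bool
detached M = allLab λ u → allLab λ v → onB u ∧ M u v ⇒ onB v

twoSided : ∀ {m} → (Lab m → Lab m → Bool) → Bool
twoSided M = allLab λ u → allLab λ v → M u v ⇒ (xSide u == not (xSide v))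

swapHubs : ∀ {m} → Bool → Lab m → Lab m
swapHubs true x = y
swapHubs true y = x
swapHubs _    u = u

flipPairs : ∀ {m} → (Fin m → Bool) → Lab m → Lab m
flipPairs φ x     = x
flipPairs φ y     = y
flipPairs φ (a i) = if φ i then b i else a i
flipPairs φ (b i) = if φ i then a i else b i

mapLab : ∀ {k m} → (Fin k → Fin m) → Lab k → Lab m
mapLab ι x     = x
mapLab ι y     = y
mapLab ι (a i) = a (ι i)
mapLab ι (b i) = b (ι i)

-- The sixteen symmetries of the partition into two singletons and two pairs.
relabel₂ : Vec Bool 4 → Lab 2 → Lab 2
relabel₂ (hubs ∷ flip₀ ∷ flip₁ ∷ pairs ∷ []) =
  swapHubs hubs ∘ flipPairs (λ { zero → flip₀ ; (suc zero) → flip₁ }) ∘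
  mapLab (if pairs then opposite else id)

-- By `check₂`, every atom-free model that is neither detached nor two-sided agrees with one of
-- these up to `relabel₂`; `catalogue₂-distinct` separates them.
catalogue₂ : Vec (Lab 2 → Lab 2 → Bool) 7
catalogue₂ =
  model₂ normalKind    triangleKind (cross false false false true ) ∷
  model₂ lowKind       triangleKind (cross false false false true ) ∷
  model₂ normalKind    normalKind   (cross false false false true ) ∷
  model₂ lowKind       normalKind   (cross false false false true ) ∷
  -- This entry and the next coincide with `half 2 true false` and `half 2 true true`.
  model₂ lowKind       normalKind   (cross false false true  false) ∷
  model₂ lowKind       highKind     (cross false false true  false) ∷
  model₂ lowKind       lowKind      (cross false false false true ) ∷ []
  where
  normalKind   = kind false false true
  triangleKind = kind false true  false
  lowKind      = kind false true  true
  highKind     = kind true  false true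

classified₂ : (Lab 2 → Lab 2 → Bool) → Bool
classified₂ M = detached M ∨ twoSided M ∨
  (anyᵇ λ i → anyBits 4 λ σ → same (λ u v → M (relabel₂ σ u) (relabel₂ σ v)) (lookup catalogue₂ i))

-- Five kinds are normal and fifteen crosses are joined, which makes 375 models. Besides settling m
-- = 2, this yields compatibility of any two pairs of a larger graph, which keeps `check₃` small.
check₂ : Bool
check₂ = allBits 3 λ k₀ → normal k₀ ⇒ allBits 3 λ k₁ → normal k₁ ⇒
         allBits 4 λ c → joined c ⇒
         compatible k₀ k₁ c ∧ classified₂ (model₂ k₀ k₁ c) ∨ hasAtom (model₂ k₀ k₁ c)

opaque
  unfolding allLab

  check₂-true : check₂ ≡ true
  check₂-true = refl

-- The hexagon x, a₀, b₁, b₂, b₀, y with two further vertices a₁ and a₂, each joined to both x and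
-- y.
sporadic₃ : Lab 3 → Lab 3 → Bool
sporadic₃ = model₃ (kind false false true) (kind false true false) (kind false true false)
  (cross false true false false) (cross false false false true) (cross false false false true)

-- In a normal kind that is not free, the only neighbour of x or y is a, and it
-- sees both.
free : Kind → Bool
free (kind _ _ y~b) = y~b

-- For pairs with y ~ b, an edge a i ~ b j says that pair j precedes pair i.
orderly : Kind → Kind → Kind → Cross → Cross → Cross → Bool
orderly (kind x~b₀ y~a₀ y~b₀) (kind _ _ y~b₁) (kind _ _ y~b₂)
        (cross aa₀₁ ab₀₁ ba₀₁ bb₀₁) (cross _ ab₀₂ _ _) (cross _ ab₁₂ _ _) =
  y~b₀ ∧ y~b₁ ∧ y~b₂ ⇒
    not aa₀₁ ∧ not bb₀₁ ∧ (ba₀₁ == not ab₀₁) ∧ (y~a₀ ⇒ ba₀₁) ∧ (x~b₀ ⇒ ab₀₁) ∧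
    (ab₀₁ ∧ ab₁₂ ⇒ ab₀₂)

notLonely : Kind → Kind → Kind → Bool
notLonely k₀ k₁ k₂ = not (not (free k₀) ∧ free k₁ ∧ free k₂)

-- Both a's are common neighbours of x and y here, and the edge between compatible pairs avoids
-- those.
bb-joined : Kind → Kind → Cross → Bool
bb-joined k₀ k₁ (cross _ _ _ bb) = not (free k₀) ∧ not (free k₁) ⇒ bb

-- Serves as a pigeonhole: among three pairs that are not free, a free pair would have to treat two
-- alike.
alternating : Kind → Kind → Kind → Cross → Cross → Bool
alternating k₀ k₁ k₂ (cross _ ab₀₁ _ _) (cross _ ab₀₂ _ _) =
  free k₀ ∧ not (free k₁) ∧ not (free k₂) ⇒ (ab₀₁ == not ab₀₂)

isSporadic : Kind → Kind → Kind → Cross → Cross → Cross → Bool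
isSporadic k₀ k₁ k₂ c₀₁@(cross _ ab₀₁ _ _) c₀₂ c₁₂ =
  free k₀ ∧ not (free k₁) ∧ not (free k₂) ∧ ab₀₁ ⇒
    same (model₃ k₀ k₁ k₂ c₀₁ c₀₂ c₁₂) sporadic₃

-- The number of pairs that are not free decides the shape: none gives a linear order, one is
-- impossible, two give `sporadic₃` up to the order of the pairs, and three cut the b's off from the
-- rest.
wellFormed₃ : Kind → Kind → Kind → Cross → Cross → Cross → Bool
wellFormed₃ k₀ k₁ k₂ c₀₁ c₀₂ c₁₂ =
  orderly k₀ k₁ k₂ c₀₁ c₀₂ c₁₂ ∧ notLonely k₀ k₁ k₂ ∧ bb-joined k₀ k₁ c₀₁ ∧
  (not (free k₀) ∧ not (free k₁) ∧ not (free k₂) ⇒ detached (model₃ k₀ k₁ k₂ c₀₁ c₀₂ c₁₂)) ∧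
  alternating k₀ k₁ k₂ c₀₁ c₀₂ ∧ isSporadic k₀ k₁ k₂ c₀₁ c₀₂ c₁₂

check₃ : Bool
check₃ = allBits 3 λ k₀ → normal k₀ ⇒ allBits 3 λ k₁ → normal k₁ ⇒
         allBits 4 λ c₀₁ → compatible k₀ k₁ c₀₁ ⇒
         allBits 3 λ k₂ → normal k₂ ⇒
         allBits 4 λ c₀₂ → compatible k₀ k₂ c₀₂ ⇒
         allBits 4 λ c₁₂ → compatible k₁ k₂ c₁₂ ⇒
         wellFormed₃ k₀ k₁ k₂ c₀₁ c₀₂ c₁₂ ∨ hasAtom (model₃ k₀ k₁ k₂ c₀₁ c₀₂ c₁₂)

opaque
  unfolding allLab

  check₃-true : check₃ ≡ true
  check₃-true = refl

-- Colour classes of a complete coloring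

encode : ∀ {m} → Lab m → Fin (2 + (m + m))
encode {m} x     = zero
encode {m} y     = suc zero
encode {m} (a i) = suc (suc (i ↑ˡ m))
encode {m} (b i) = suc (suc (m ↑ʳ i))

pairEnd : ∀ {m} → Fin m ⊎ Fin m → Lab m
pairEnd (inj₁ i) = a i
pairEnd (inj₂ i) = b i

decode : ∀ {m} → Fin (2 + (m + m)) → Lab m
decode {m} zero          = x
decode {m} (suc zero)    = y
decode {m} (suc (suc i)) = pairEnd (splitAt m i)

decode-encode : ∀ {m} (u : Lab m) → decode (encode u) ≡ u
decode-encode     x     = refl
decode-encode     y     = refl
decode-encode {m} (a i) = cong pairEnd (Fin.splitAt-↑ˡ m i m)
decode-encode {m} (b i) = cong pairEnd (Fin.splitAt-↑ʳ m m i)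

encode-decode : ∀ {m} (i : Fin (2 + (m + m))) → encode {m} (decode i) ≡ i
encode-decode     zero          = refl
encode-decode     (suc zero)    = refl
encode-decode {m} (suc (suc i)) with splitAt m i in eq
... | inj₁ j = cong (λ k → suc (suc k)) (trans (≡-sym (cong (join m m) eq)) (Fin.join-splitAt m m i))
... | inj₂ j = cong (λ k → suc (suc k)) (trans (≡-sym (cong (join m m) eq)) (Fin.join-splitAt m m i))

Injective : ∀ {A B : Set} → (A → B) → Set
Injective f = ∀ {u v} → f u ≡ f v → u ≡ v

decode-injective : ∀ {m} → Injective (decode {m})
decode-injective {m} {i} {j} eq =
  trans (≡-sym (encode-decode {m} i)) (trans (cong encode eq) (encode-decode {m} j))

involutive⇒injective : ∀ {A : Set} {f : A → A} → (∀ u → f (f u) ≡ u) → Injective f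
involutive⇒injective {f = f} inv {u} {v} eq = trans (≡-sym (inv u)) (trans (cong f eq) (inv v))

swapHubs-involutive : ∀ {m} s (u : Lab m) → swapHubs s (swapHubs s u) ≡ u
swapHubs-involutive true  x     = refl
swapHubs-involutive true  y     = refl
swapHubs-involutive true  (a _) = refl
swapHubs-involutive true  (b _) = refl
swapHubs-involutive false _     = refl

flipPairs-involutive : ∀ {m} (φ : Fin m → Bool) (u : Lab m) → flipPairs φ (flipPairs φ u) ≡ u
flipPairs-involutive φ x = refl
flipPairs-involutive φ y = refl
flipPairs-involutive φ (a i) with φ i in eq
... | true  rewrite eq = refl
... | false rewrite eq = refl
flipPairs-involutive φ (b i) with φ i in eq
... | true  rewrite eq = refl
... | false rewrite eq = refl

mapLab-injective : ∀ {k m} {ι : Fin k → Fin m} → Injective ι → Injective (mapLab ι)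
mapLab-injective inj {x}   {x}   eq = refl
mapLab-injective inj {y}   {y}   eq = refl
mapLab-injective inj {a i} {a j} eq = cong a (inj (a-injective eq))
  where
  a-injective : ∀ {m} {i j : Fin m} → a i ≡ a j → i ≡ j
  a-injective refl = refl
mapLab-injective inj {b i} {b j} eq = cong b (inj (b-injective eq))
  where
  b-injective : ∀ {m} {i j : Fin m} → b i ≡ b j → i ≡ j
  b-injective refl = refl

relabel₂-injective : ∀ σ → Injective (relabel₂ σ)
relabel₂-injective (hubs ∷ flip₀ ∷ flip₁ ∷ pairs ∷ []) =
  mapLab-injective (pairs-injective pairs) ∘
  involutive⇒injective {f = flipPairs _} (flipPairs-involutive _) ∘
  involutive⇒injective {f = swapHubs hubs} (swapHubs-involutive hubs)
  where
  pairs-injective : ∀ p → Injective (if p then opposite {2} else id)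
  pairs-injective true  = involutive⇒injective Fin.opposite-involutive
  pairs-injective false = id

colour : ∀ {m} → Lab m → Fin (2 + m)
colour x     = zero
colour y     = suc zero
colour (a i) = suc (suc i)
colour (b i) = suc (suc i)

-- M is a simple graph for which colour is a complete coloring.
record System {m : ℕ} (M : Lab m → Lab m → Bool) : Set where
  field
    symm     : ∀ u v → M u v ≡ M v u
    irr      : ∀ u → M u u ≡ false
    proper   : ∀ u v → M u v ≡ true → colour u ≢ colour v
    complete : ∀ {i j} → i ≢ j → ∃[ u ] ∃[ v ] (M u v ≡ true × colour u ≡ i × colour v ≡ j)

infix 4 _≃_
_≃_ : ∀ {m} → Graph → (Lab m → Lab m → Bool) → Set
_≃_ {m} G M = n G ≡ 2 + (m + m) × Σ (Lab m → Fin (n G)) λ ℓ →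
  Injective ℓ × (∀ u v → E G (ℓ u) (ℓ v) ≡ M u v)

≃-relabel : ∀ {m} {G} {M : Lab m → Lab m → Bool} (σ : Lab m → Lab m) → Injective σ →
            G ≃ M → G ≃ (λ u v → M (σ u) (σ v))
≃-relabel σ σ-inj (size , ℓ , ℓ-inj , edges) = size , ℓ ∘ σ , σ-inj ∘ ℓ-inj , λ u v → edges (σ u) (σ v)

≃-cong : ∀ {m} {G} {M N : Lab m → Lab m → Bool} → (∀ u v → M u v ≡ N u v) → G ≃ M → G ≃ N
≃-cong eq (size , ℓ , ℓ-inj , edges) = size , ℓ , ℓ-inj , λ u v → trans (edges u v) (eq u v)

labelling-surjective : ∀ {m k} → k ≡ 2 + (m + m) → (ℓ : Lab m → Fin k) → Injective ℓ →
                       ∀ v → ∃[ u ] ℓ u ≡ v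
labelling-surjective {m} refl ℓ ℓ-inj v =
  let i , eq = injective⇒surjective (ℓ ∘ decode) (decode-injective {m} ∘ ℓ-inj) v
  in decode i , eq

-- Renumbers the colours so that the two that may be singletons become 0 and 1; skipping p and then
-- q lists the others.
extend-injective : ∀ {k} {p q : Fin (2 + k)} → p ≢ q →
  Σ (Fin (2 + k) → Fin (2 + k)) λ κ → κ zero ≡ p × κ (suc zero) ≡ q × Injective κ
extend-injective {k} {p} {q} p≢q = κ , refl , Fin.punchIn-punchOut p≢q , inj
  where
  κ : Fin (2 + k) → Fin (2 + k)
  κ zero          = p
  κ (suc zero)    = punchIn p (punchOut p≢q)
  κ (suc (suc i)) = punchIn p (punchIn (punchOut p≢q) i)
  inj : Injective κ
  inj {zero}        {zero}        eq = refl
  inj {zero}        {suc zero}    eq = contradiction (≡-sym eq) (Fin.punchInᵢ≢i p _)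
  inj {zero}        {suc (suc j)} eq = contradiction (≡-sym eq) (Fin.punchInᵢ≢i p _)
  inj {suc zero}    {zero}        eq = contradiction eq (Fin.punchInᵢ≢i p _)
  inj {suc (suc i)} {zero}        eq = contradiction eq (Fin.punchInᵢ≢i p _)
  inj {suc zero}    {suc zero}    eq = refl
  inj {suc zero}    {suc (suc j)} eq =
    contradiction (≡-sym (Fin.punchIn-injective p _ _ eq)) (Fin.punchInᵢ≢i _ j)
  inj {suc (suc i)} {suc zero}    eq =
    contradiction (Fin.punchIn-injective p _ _ eq) (Fin.punchInᵢ≢i _ i)
  inj {suc (suc i)} {suc (suc j)} eq =
    cong (λ k → suc (suc k)) (Fin.punchIn-injective _ i j (Fin.punchIn-injective p _ _ eq))

module Classes (G : Graph) (noAtom : ¬ Atom (E G)) {m} (2≤m : 2 ≤ m)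
               (coloring : HasCompleteColoring G (2 + m)) where

  c : Fin (n G) → Fin (2 + m)
  c = proj₁ coloring

  c-proper : Proper G c
  c-proper = proj₁ (proj₂ coloring)

  c-surjective : Surjective c
  c-surjective = proj₁ (proj₂ (proj₂ coloring))

  c-complete : ∀ i j → i ≢ j → ∃[ u ] ∃[ v ] (Adj G u v × c u ≡ i × c v ≡ j)
  c-complete = proj₂ (proj₂ (proj₂ coloring))

  rep : Fin (2 + m) → Fin (n G)
  rep i = proj₁ (c-surjective i)

  c-rep : ∀ i → c (rep i) ≡ i
  c-rep i = proj₂ (c-surjective i)

  Second : Fin (2 + m) → Set
  Second i = ∃[ v ] (c v ≡ i × v ≢ rep i)

  second? : ∀ i → Dec (Second i)
  second? i = Fin.any? λ v → (c v Fin.≟ i) ×-dec ¬? (v Fin.≟ rep i)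

  singleton : ∀ {i v} → ¬ Second i → c v ≡ i → v ≡ rep i
  singleton {i} {v} ¬2 cv with v Fin.≟ rep i
  ... | yes eq = eq
  ... | no neq = contradiction (v , cv , neq) ¬2

  -- Three singleton classes form a triangle, and any further class, coloured
  -- 0, completes it to an atom.
  no-three-singletons : ∀ {i j k} → i ≢ j → i ≢ k → j ≢ k →
                        ¬ Second i → ¬ Second j → Second k
  no-three-singletons {i} {j} {k} i≢j i≢k j≢k ¬2i ¬2j with second? k
  ... | yes 2k = 2k
  ... | no ¬2k with missed-value (s≤s (s≤s 2≤m)) (lookup (i ∷ j ∷ k ∷ []))
  ...   | l , fresh = contradiction atom noAtom
    where
    ~singletons : ∀ {p q} → p ≢ q → ¬ Second p → ¬ Second q → Adj G (rep p) (rep q)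
    ~singletons p≢q ¬2p ¬2q = let u , v , u~v , cu , cv = c-complete _ _ p≢q in
      subst₂ (Adj G) (singleton ¬2p cu) (singleton ¬2q cv) u~v
    ~l : ∀ {p} → p ≢ l → ¬ Second p → ∃[ v ] (Adj G (rep p) v × c v ≡ l)
    ~l p≢l ¬2p = let u , v , u~v , cu , cv = c-complete _ _ p≢l in
      v , subst (λ w → Adj G w v) (singleton ¬2p cu) u~v , cv
    I = ~l (fresh zero) ¬2i
    J = ~l (fresh (suc zero)) ¬2j
    K = ~l (fresh (suc (suc zero))) ¬2k
    l≁l : ∀ {u v} → c u ≡ l → c v ≡ l → E G u v ≡ false
    l≁l cu cv = ≢true⇒false λ u~v → c-proper _ _ u~v (trans cu (≡-sym cv))
    i₀ = proj₂ (proj₂ I)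
    j₀ = proj₂ (proj₂ J)
    k₀ = proj₂ (proj₂ K)
    atom : Atom (E G)
    atom = record
      { r = rep k ; u₂ = rep j ; u₁ = rep i ; w₁ = rep i
      ; r~u₂ = ~singletons (j≢k ∘ ≡-sym) ¬2k ¬2j
      ; r~u₁ = ~singletons (i≢k ∘ ≡-sym) ¬2k ¬2i
      ; u₂~w₁ = ~singletons (i≢j ∘ ≡-sym) ¬2j ¬2i
      ; r~u₀ = proj₁ (proj₂ K) ; u₂~w₀ = proj₁ (proj₂ J)
      ; u₁~z = proj₁ (proj₂ I) ; w₁~t = proj₁ (proj₂ I)
      ; u₁≁w₁ = irrefl G _ ; u₀≁w₀ = l≁l k₀ j₀ ; u₀≁z = l≁l k₀ i₀ ; u₀≁t = l≁l k₀ i₀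
      ; w₀≁z = l≁l j₀ i₀ ; w₀≁t = l≁l j₀ i₀ ; z≁t = l≁l i₀ i₀ }

  -- Covers zero, one and two singletons at once: p and q are merely the colours that may lack a
  -- second vertex. When the vertex count is minimal, the labels below use up all vertices, and
  -- these two classes are then singletons.
  exceptional-colours : ∃[ p ] ∃[ q ] (p ≢ q × (∀ {i} → i ≢ p → i ≢ q → Second i))
  exceptional-colours with Fin.any? (λ i → ¬? (second? i))
  ... | no none = zero , suc zero , (λ ()) , λ {i} _ _ → decide i
    where
    decide : ∀ i → Second i
    decide i with second? i
    ... | yes 2i = 2i
    ... | no ¬2i = contradiction (i , ¬2i) none
  ... | yes (p , ¬2p) with Fin.any? (λ i → ¬? (i Fin.≟ p) ×-dec ¬? (second? i))
  ...   | yes (q , q≢p , ¬2q) = p , q , q≢p ∘ ≡-sym ,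
          λ i≢p i≢q → no-three-singletons (q≢p ∘ ≡-sym) (i≢p ∘ ≡-sym) (i≢q ∘ ≡-sym) ¬2p ¬2q
  ...   | no none = p , punchIn p zero , Fin.punchInᵢ≢i p zero ∘ ≡-sym , λ {i} i≢p _ → decide i i≢p
    where
    decide : ∀ i → i ≢ p → Second i
    decide i i≢p with second? i
    ... | yes 2i = 2i
    ... | no ¬2i = contradiction (i , i≢p , ¬2i) none

  private
    p = proj₁ exceptional-colours
    q = proj₁ (proj₂ exceptional-colours)
    K = extend-injective (proj₁ (proj₂ (proj₂ exceptional-colours)))
    κ = proj₁ K
    κ-injective : Injective κ
    κ-injective = proj₂ (proj₂ (proj₂ K))

    second : ∀ i → Second (κ (suc (suc i)))
    second i = proj₂ (proj₂ (proj₂ exceptional-colours))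
      (λ eq → contradiction (κ-injective {suc (suc i)} {zero} (trans eq (≡-sym (proj₁ (proj₂ K))))) λ ())
      (λ eq → contradiction (κ-injective {suc (suc i)} {suc zero} (trans eq (≡-sym (proj₁ (proj₂ (proj₂ K)))))) λ ())

  label : Lab m → Fin (n G)
  label x     = rep (κ zero)
  label y     = rep (κ (suc zero))
  label (a i) = rep (κ (suc (suc i)))
  label (b i) = proj₁ (second i)

  c-label : ∀ u → c (label u) ≡ κ (colour u)
  c-label x     = c-rep _
  c-label y     = c-rep _
  c-label (a i) = c-rep _
  c-label (b i) = proj₁ (proj₂ (second i))

  same-colour : ∀ {u v} → label u ≡ label v → colour u ≡ colour v
  same-colour {u} {v} eq = κ-injective (trans (≡-sym (c-label u)) (trans (cong c eq) (c-label v)))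

  label-injective : Injective label
  label-injective {u} {v} eq = go u v eq (same-colour {u} {v} eq)
    where
    go : ∀ u v → label u ≡ label v → colour u ≡ colour v → u ≡ v
    go x x _ _ = refl
    go y y _ _ = refl
    go (a i) (a .i) _ refl = refl
    go (b i) (b .i) _ refl = refl
    go (a i) (b .i) eq refl = contradiction (≡-sym eq) (proj₂ (proj₂ (second i)))
    go (b i) (a .i) eq refl = contradiction eq (proj₂ (proj₂ (second i)))

  size : 2 + (m + m) ≤ n G
  size = Fin.injective⇒≤ (decode-injective {m} ∘ label-injective)

  -- With exactly 2 + 2m vertices the injective labelling is onto, so the edges that witness
  -- completeness can be named by labels.
  system : n G ≡ 2 + (m + m) → Σ (Lab m → Lab m → Bool) λ M → G ≃ M × System M
  system eq = (λ u v → E G (label u) (label v)) , (eq , label , label-injective , λ _ _ → refl) , record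
    { symm = λ u v → sym G _ _
    ; irr = λ u → irrefl G _
    ; proper = λ u v u~v same → c-proper _ _ u~v
        (trans (c-label u) (trans (cong κ same) (≡-sym (c-label v))))
    ; complete = λ {i} {j} i≢j → let u , v , u~v , cu , cv = c-complete (κ i) (κ j) (i≢j ∘ κ-injective)
                                     u′ , u′≡ = covers u
                                     v′ , v′≡ = covers v
        in u′ , v′ , subst₂ (Adj G) (≡-sym u′≡) (≡-sym v′≡) u~v ,
           κ-injective (trans (≡-sym (c-label u′)) (trans (cong c u′≡) cu)) ,
           κ-injective (trans (≡-sym (c-label v′)) (trans (cong c v′≡) cv)) }
    where
    covers = labelling-surjective eq label label-injective

colour-x : ∀ {m} {u : Lab m} → colour u ≡ zero → u ≡ x
colour-x {u = x} _ = refl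

colour-y : ∀ {m} {u : Lab m} → colour u ≡ suc zero → u ≡ y
colour-y {u = y} _ = refl

colour-pair : ∀ {m} {u : Lab m} {i} → colour u ≡ suc (suc i) → u ≡ a i ⊎ u ≡ b i
colour-pair {u = a _} refl = inj₁ refl
colour-pair {u = b _} refl = inj₂ refl

kindOf : ∀ {m} → (Lab m → Lab m → Bool) → Fin m → Kind
kindOf M i = kind (M x (b i)) (M y (a i)) (M y (b i))

crossOf : ∀ {m} → (Lab m → Lab m → Bool) → Fin m → Fin m → Cross
crossOf M i j = cross (M (a i) (a j)) (M (a i) (b j)) (M (b i) (a j)) (M (b i) (b j))

module SystemFacts {m} {M : Lab m → Lab m → Bool} (S : System M) where
  open System S

  x~y : M x y ≡ true
  x~y = let u , v , u~v , cu , cv = complete {zero} {suc zero} (λ ()) in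
        subst₂ (λ u v → M u v ≡ true) (colour-x cu) (colour-y cv) u~v

  x~pair : ∀ i → M x (a i) ∨ M x (b i) ≡ true
  x~pair i with complete {zero} {suc (suc i)} (λ ())
  ... | u , v , u~v , cu , cv with colour-x cu | colour-pair cv
  ... | refl | inj₁ refl = ∨-introˡ u~v
  ... | refl | inj₂ refl = ∨-introʳ u~v

  y~pair : ∀ i → M y (a i) ∨ M y (b i) ≡ true
  y~pair i with complete {suc zero} {suc (suc i)} (λ ())
  ... | u , v , u~v , cu , cv with colour-y cu | colour-pair cv
  ... | refl | inj₁ refl = ∨-introˡ u~v
  ... | refl | inj₂ refl = ∨-introʳ u~v

  pair~pair : ∀ {i j} → i ≢ j → joined (crossOf M i j) ≡ true
  pair~pair {i} {j} i≢j with complete {suc (suc i)} {suc (suc j)} (λ { refl → i≢j refl })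
  ... | u , v , u~v , cu , cv with colour-pair cu | colour-pair cv
  ... | inj₁ refl | inj₁ refl = ∨-introˡ u~v
  ... | inj₁ refl | inj₂ refl = ∨-introʳ {M (a i) (a j)} (∨-introˡ u~v)
  ... | inj₂ refl | inj₁ refl = ∨-introʳ {M (a i) (a j)} (∨-introʳ {M (a i) (b j)} (∨-introˡ u~v))
  ... | inj₂ refl | inj₂ refl =
    ∨-introʳ {M (a i) (a j)} (∨-introʳ {M (a i) (b j)} (∨-introʳ {M (b i) (a j)} u~v))

  a≁b : ∀ i → M (a i) (b i) ≡ false
  a≁b i = ≢true⇒false λ a~b → proper _ _ a~b refl

  no-self-cross : ∀ i → crossOf M i i ≡ no-cross
  no-self-cross i rewrite irr (a i) | a≁b i | trans (symm (b i) (a i)) (a≁b i) | irr (b i) = refl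

  cross-flipped : ∀ i j → crossOf M j i ≡ flipped (crossOf M i j)
  cross-flipped i j
    rewrite symm (a j) (a i) | symm (a j) (b i) | symm (b j) (a i) | symm (b j) (b i) = refl

-- Normal form, and restriction to two or three pairs

record Normal {m : ℕ} (M : Lab m → Lab m → Bool) : Set where
  field
    system      : System M
    x~a         : ∀ i → M x (a i) ≡ true
    normal-kind : ∀ i → normal (kindOf M i) ≡ true

oriented : Bool → Bool → Bool → Bool → Bool
oriented xa xb ya yb = xa ∧ normal (kind xb ya yb)

opaque
  unfolding allLab

  -- Sixteen cases: a pair that meets both x and y is in normal form as it stands or after
  -- exchanging its two vertices.
  orientable : ∀ xa xb ya yb → xa ∨ xb ≡ true → ya ∨ yb ≡ true →
               oriented xa xb ya yb ≡ false → oriented xb xa yb ya ≡ true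
  orientable xa xb ya yb xab yab unoriented = ⇒-elim (⇒-elim (⇒-elim (allBits-sound 4
    {λ { (xa ∷ xb ∷ ya ∷ yb ∷ []) → xa ∨ xb ⇒ ya ∨ yb ⇒ not (oriented xa xb ya yb) ⇒ oriented xb xa yb ya }}
    refl (xa ∷ xb ∷ ya ∷ yb ∷ [])) xab) yab) (not-false unoriented)

normalise : ∀ {m} {M : Lab m → Lab m → Bool} → System M →
            Σ (Lab m → Lab m) λ σ → Injective σ × Normal (λ u v → M (σ u) (σ v))
normalise {m} {M} S = σ , involutive⇒injective {f = σ} (flipPairs-involutive φ) , record
  { system = record
    { symm = λ u v → symm (σ u) (σ v)
    ; irr = λ u → irr (σ u)
    ; proper = λ u v u~v same → proper (σ u) (σ v) u~v (trans (colour-σ u) (trans same (≡-sym (colour-σ v))))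
    ; complete = λ i≢j → let u , v , u~v , cu , cv = complete i≢j in
        σ u , σ v ,
        subst₂ (λ u v → M u v ≡ true) (≡-sym (flipPairs-involutive φ u)) (≡-sym (flipPairs-involutive φ v)) u~v ,
        trans (colour-σ u) cu , trans (colour-σ v) cv }
  ; x~a = λ i → proj₁ (∧-elim (at i (φ i) refl))
  ; normal-kind = λ i → proj₂ (∧-elim {M x (σ (a i))} (at i (φ i) refl)) }
  where
  open System S
  open SystemFacts S
  φ : Fin m → Bool
  φ i = not (oriented (M x (a i)) (M x (b i)) (M y (a i)) (M y (b i)))
  σ : Lab m → Lab m
  σ = flipPairs φ
  colour-σ : ∀ u → colour (σ u) ≡ colour u
  colour-σ x = refl
  colour-σ y = refl
  colour-σ (a i) with φ i
  ... | true  = refl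
  ... | false = refl
  colour-σ (b i) with φ i
  ... | true  = refl
  ... | false = refl
  at : ∀ i β → φ i ≡ β →
       oriented (M x (if β then b i else a i)) (M x (if β then a i else b i))
                (M y (if β then b i else a i)) (M y (if β then a i else b i)) ≡ true
  at i true  eq = orientable (M x (a i)) (M x (b i)) (M y (a i)) (M y (b i)) (x~pair i) (y~pair i) (not-true eq)
  at i false eq = ≢false⇒true λ unoriented → true≢false (not-false unoriented) eq

model-cong : ∀ {m} {K K′ : Fin m → Kind} {C C′} → (∀ i → K i ≡ K′ i) → (∀ i j → C i j ≡ C′ i j) →
             ∀ u v → model K C u v ≡ model K′ C′ u v
model-cong K≡ C≡ x     x     = refl
model-cong K≡ C≡ x     y     = refl
model-cong K≡ C≡ x     (a i) = refl
model-cong K≡ C≡ x     (b i) rewrite K≡ i = refl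
model-cong K≡ C≡ y     x     = refl
model-cong K≡ C≡ y     y     = refl
model-cong K≡ C≡ y     (a i) rewrite K≡ i = refl
model-cong K≡ C≡ y     (b i) rewrite K≡ i = refl
model-cong K≡ C≡ (a i) x     = refl
model-cong K≡ C≡ (a i) y     rewrite K≡ i = refl
model-cong K≡ C≡ (a i) (a j) rewrite C≡ i j = refl
model-cong K≡ C≡ (a i) (b j) rewrite C≡ i j = refl
model-cong K≡ C≡ (b i) x     rewrite K≡ i = refl
model-cong K≡ C≡ (b i) y     rewrite K≡ i = refl
model-cong K≡ C≡ (b i) (a j) rewrite C≡ i j = refl
model-cong K≡ C≡ (b i) (b j) rewrite C≡ i j = refl

module NormalFacts {m} {M : Lab m → Lab m → Bool} (N : Normal M) (noAtom : ¬ Atom M) where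
  open Normal N
  open System system
  open SystemFacts system

  -- The edge xy and all edges from x to an a are fixed by the normal form, so kinds and crosses
  -- carry everything that remains.
  submodel : ∀ {k} (ι : Fin k → Fin m) u v →
    M (mapLab ι u) (mapLab ι v) ≡ model (kindOf M ∘ ι) (λ i j → crossOf M (ι i) (ι j)) u v
  submodel ι x     x     = irr x
  submodel ι x     y     = x~y
  submodel ι x     (a i) = x~a (ι i)
  submodel ι x     (b i) = refl
  submodel ι y     x     = trans (symm y x) x~y
  submodel ι y     y     = irr y
  submodel ι y     (a i) = refl
  submodel ι y     (b i) = refl
  submodel ι (a i) x     = trans (symm _ _) (x~a (ι i))
  submodel ι (a i) y     = symm _ _
  submodel ι (a i) (a j) = refl
  submodel ι (a i) (b j) = refl
  submodel ι (b i) x     = symm _ _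
  submodel ι (b i) y     = symm _ _
  submodel ι (b i) (a j) = refl
  submodel ι (b i) (b j) = refl

  no-atom-in : ∀ {k} {N : Lab k → Lab k → Bool} (f : Lab k → Lab m) →
               (∀ u v → M (f u) (f v) ≡ N u v) → hasAtom N ≡ false
  no-atom-in f eq = ≢true⇒false λ found → noAtom (atom-pullback f eq (hasAtom⇒atom _ found))

  module _ {i j : Fin m} (i≢j : i ≢ j) where

    embed₂ : Fin 2 → Fin m
    embed₂ = lookup (i ∷ j ∷ [])

    submodel₂ : ∀ u v → M (mapLab embed₂ u) (mapLab embed₂ v) ≡
                        model₂ (kindOf M i) (kindOf M j) (crossOf M i j) u v
    submodel₂ u v = trans (submodel embed₂ u v) (model-cong
      (λ { zero → refl ; (suc zero) → refl })
      (λ { zero zero → no-self-cross i ; zero (suc zero) → refl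
         ; (suc zero) zero → cross-flipped i j ; (suc zero) (suc zero) → no-self-cross j }) u v)

    checked₂ : compatible (kindOf M i) (kindOf M j) (crossOf M i j) ∧
               classified₂ (model₂ (kindOf M i) (kindOf M j) (crossOf M i j)) ≡ true
    checked₂ with ∨-elim (⇒-elim (allBits-sound 4 (⇒-elim (allBits-sound 3
                    (⇒-elim (allBits-sound 3 check₂-true (kindOf M i)) (normal-kind i))
                    (kindOf M j)) (normal-kind j)) (crossOf M i j)) (pair~pair i≢j))
    ... | inj₁ good = good
    ... | inj₂ atom = contradiction (no-atom-in (mapLab embed₂) submodel₂) (true≢false atom)

    compatible-pairs : compatible (kindOf M i) (kindOf M j) (crossOf M i j) ≡ true
    compatible-pairs = proj₁ (∧-elim checked₂)

  module _ {i j k : Fin m} (i≢j : i ≢ j) (i≢k : i ≢ k) (j≢k : j ≢ k) where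

    embed₃ : Fin 3 → Fin m
    embed₃ = lookup (i ∷ j ∷ k ∷ [])

    embed₃-injective : Injective embed₃
    embed₃-injective {zero}         {zero}         _  = refl
    embed₃-injective {zero}         {suc zero}     eq = contradiction eq i≢j
    embed₃-injective {zero}         {suc (suc zero)} eq = contradiction eq i≢k
    embed₃-injective {suc zero}     {zero}         eq = contradiction (≡-sym eq) i≢j
    embed₃-injective {suc zero}     {suc zero}     _  = refl
    embed₃-injective {suc zero}     {suc (suc zero)} eq = contradiction eq j≢k
    embed₃-injective {suc (suc zero)} {zero}       eq = contradiction (≡-sym eq) i≢k
    embed₃-injective {suc (suc zero)} {suc zero}   eq = contradiction (≡-sym eq) j≢k
    embed₃-injective {suc (suc zero)} {suc (suc zero)} _ = refl

    model-at : Lab 3 → Lab 3 → Bool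
    model-at = model₃ (kindOf M i) (kindOf M j) (kindOf M k) (crossOf M i j) (crossOf M i k) (crossOf M j k)

    submodel₃ : ∀ u v → M (mapLab embed₃ u) (mapLab embed₃ v) ≡ model-at u v
    submodel₃ u v = trans (submodel embed₃ u v) (model-cong
      (λ { zero → refl ; (suc zero) → refl ; (suc (suc zero)) → refl })
      (λ { zero zero → no-self-cross i ; zero (suc zero) → refl ; zero (suc (suc zero)) → refl
         ; (suc zero) zero → cross-flipped i j ; (suc zero) (suc zero) → no-self-cross j
         ; (suc zero) (suc (suc zero)) → refl
         ; (suc (suc zero)) zero → cross-flipped i k ; (suc (suc zero)) (suc zero) → cross-flipped j k
         ; (suc (suc zero)) (suc (suc zero)) → no-self-cross k }) u v)

    well-formed : wellFormed₃ (kindOf M i) (kindOf M j) (kindOf M k)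
                              (crossOf M i j) (crossOf M i k) (crossOf M j k) ≡ true
    well-formed with ∨-elim (⇒-elim (allBits-sound 4 (⇒-elim (allBits-sound 4 (⇒-elim (allBits-sound 3
                       (⇒-elim (allBits-sound 4 (⇒-elim (allBits-sound 3
                         (⇒-elim (allBits-sound 3 check₃-true (kindOf M i)) (normal-kind i))
                         (kindOf M j)) (normal-kind j))
                         (crossOf M i j)) (compatible-pairs i≢j))
                       (kindOf M k)) (normal-kind k))
                       (crossOf M i k)) (compatible-pairs i≢k))
                       (crossOf M j k)) (compatible-pairs j≢k))
    ... | inj₁ good = good
    ... | inj₂ atom = contradiction (no-atom-in (mapLab embed₃) submodel₃) (true≢false atom)

-- Sorting the pairs

<ᵇ⇒< : ∀ {k l} → (k <ᵇ l) ≡ true → k < l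
<ᵇ⇒< {k} {l} eq = ℕ.<ᵇ⇒< k l (subst T (≡-sym eq) _)

<⇒<ᵇ : ∀ {k l} → k < l → (k <ᵇ l) ≡ true
<⇒<ᵇ {k} {l} k<l with k <ᵇ l | ℕ.<⇒<ᵇ k<l
... | true | _ = refl

≤ᵇ⇒≤ : ∀ {k l} → (k ≤ᵇ l) ≡ true → k ≤ l
≤ᵇ⇒≤ {k} {l} eq = ℕ.≤ᵇ⇒≤ k l (subst T (≡-sym eq) _)

≤⇒≤ᵇ : ∀ {k l} → k ≤ l → (k ≤ᵇ l) ≡ true
≤⇒≤ᵇ {k} {l} k≤l with k ≤ᵇ l | ℕ.≤⇒≤ᵇ k≤l
... | true | _ = refl

bool-ext : ∀ {β γ} → (β ≡ true → γ ≡ true) → (γ ≡ true → β ≡ true) → β ≡ γ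
bool-ext {true}          to from = ≡-sym (to refl)
bool-ext {false} {true}  to from = from refl
bool-ext {false} {false} to from = refl

count : ∀ {k} → (Fin k → Bool) → ℕ
count {zero}  f = 0
count {suc k} f = (if f zero then 1 else 0) + count (f ∘ suc)

count-mono : ∀ {k} {f g : Fin k → Bool} → (∀ i → f i ≡ true → g i ≡ true) → count f ≤ count g
count-mono {zero} f⊆g = z≤n
count-mono {suc k} {f} {g} f⊆g with f zero in eq
... | true  rewrite f⊆g zero eq = s≤s (count-mono (f⊆g ∘ suc))
... | false = ℕ.≤-trans (count-mono (f⊆g ∘ suc)) (ℕ.m≤n+m _ _)

count-strict : ∀ {k} {f g : Fin k → Bool} → (∀ i → f i ≡ true → g i ≡ true) →
               ∀ i → f i ≡ false → g i ≡ true → count f < count g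
count-strict {suc k} f⊆g zero    f₀ g₀ rewrite f₀ | g₀ = s≤s (count-mono (f⊆g ∘ suc))
count-strict {suc k} {f} {g} f⊆g (suc i) fᵢ gᵢ with f zero in eq
... | true  rewrite f⊆g zero eq = s≤s (count-strict (f⊆g ∘ suc) i fᵢ gᵢ)
... | false = ℕ.<-≤-trans (count-strict (f⊆g ∘ suc) i fᵢ gᵢ) (ℕ.m≤n+m _ _)

count≤ : ∀ {k} (f : Fin k → Bool) → count f ≤ k
count≤ {zero}  f = z≤n
count≤ {suc k} f with f zero
... | true  = s≤s (count≤ (f ∘ suc))
... | false = ℕ.m≤n⇒m≤1+n (count≤ (f ∘ suc))

count-bound : ∀ {k} {f : Fin k → Bool} i → f i ≡ false → count f < k
count-bound {k} {f} i fᵢ = ℕ.<-≤-trans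
  (count-strict {f = f} {g = λ _ → true} (λ _ _ → refl) i fᵢ refl) (count≤ (λ (_ : Fin k) → true))

first last : ∀ {m} → Fin m → Bool
first {m} i = allᵇ {m} λ j → toℕ i ≤ᵇ toℕ j
last  {m} i = allᵇ {m} λ j → toℕ j ≤ᵇ toℕ i

-- With x = b₀ and y = a_{m+1} this is the half graph a_i ~ b_j ⇔ j < i, with
-- the extra edge a₁a_{m+1} if lo and the extra edge b₀b_m if hi.
half : ∀ m → Bool → Bool → Lab m → Lab m → Bool
half m lo hi x     x     = false
half m lo hi x     y     = true
half m lo hi x     (a i) = true
half m lo hi x     (b i) = hi ∧ last i
half m lo hi y     x     = true
half m lo hi y     y     = false
half m lo hi y     (a i) = lo ∧ first i
half m lo hi y     (b i) = true
half m lo hi (a i) x     = true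
half m lo hi (a i) y     = lo ∧ first i
half m lo hi (a i) (a j) = false
half m lo hi (a i) (b j) = toℕ j <ᵇ toℕ i
half m lo hi (b i) x     = hi ∧ last i
half m lo hi (b i) y     = true
half m lo hi (b i) (a j) = toℕ i <ᵇ toℕ j
half m lo hi (b i) (b j) = false

-- With a i ~ b j read as "j precedes i", the fields `a≁b`, `connex` and `chain` describe a strict
-- linear order, while `lowest` and `highest` place the extra neighbours of y and x at its two ends.
record Ordered {m : ℕ} (M : Lab m → Lab m → Bool) : Set where
  field
    symm    : ∀ u v → M u v ≡ M v u
    x≁x     : M x x ≡ false
    y≁y     : M y y ≡ false
    x~y     : M x y ≡ true
    x~a     : ∀ i → M x (a i) ≡ true
    y~b     : ∀ i → M y (b i) ≡ true
    a≁a     : ∀ i j → M (a i) (a j) ≡ false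
    b≁b     : ∀ i j → M (b i) (b j) ≡ false
    a≁b     : ∀ i → M (a i) (b i) ≡ false
    connex  : ∀ {i j} → i ≢ j → M (a i) (b j) ≡ true ⊎ M (a j) (b i) ≡ true
    chain   : ∀ {i j k} → M (a i) (b j) ≡ true → M (a j) (b k) ≡ true → M (a i) (b k) ≡ true
    lowest  : ∀ {i j} → M y (a i) ≡ true → i ≢ j → M (a j) (b i) ≡ true
    highest : ∀ {i j} → M x (b i) ≡ true → i ≢ j → M (a i) (b j) ≡ true

reversal : ∀ {m} → Lab m → Lab m
reversal x     = y
reversal y     = x
reversal (a i) = b i
reversal (b i) = a i

reversal-injective : ∀ {m} → Injective (reversal {m})
reversal-injective = involutive⇒injective λ { x → refl ; y → refl ; (a _) → refl ; (b _) → refl }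

-- Exchanging x with y and every a with its b turns the order around and trades the two extra edges,
-- so the fields swap in dual pairs.
reversed : ∀ {m} {M : Lab m → Lab m → Bool} → Ordered M → Ordered (λ u v → M (reversal u) (reversal v))
reversed O = record
  { symm = λ u v → symm _ _ ; x≁x = y≁y ; y≁y = x≁x ; x~y = trans (symm _ _) x~y
  ; x~a = y~b ; y~b = x~a ; a≁a = b≁b ; b≁b = a≁a
  ; a≁b = λ i → trans (symm _ _) (a≁b i)
  ; connex = λ {i} {j} i≢j → case i j (connex i≢j)
  ; chain = λ i~j j~k → trans (symm _ _) (chain (trans (symm _ _) j~k) (trans (symm _ _) i~j))
  ; lowest = λ low i≢j → trans (symm _ _) (highest low i≢j)
  ; highest = λ high i≢j → trans (symm _ _) (lowest high i≢j) }
  where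
  open Ordered O
  case : ∀ i j → _ ⊎ _ → _ ⊎ _
  case i j (inj₁ i~j) = inj₂ (trans (symm (b j) (a i)) i~j)
  case i j (inj₂ j~i) = inj₁ (trans (symm (b i) (a j)) j~i)

module Sorting {m} {M : Lab m → Lab m → Bool} (O : Ordered M) where
  open Ordered O

  -- The number of predecessors of i. It stays below m because i does not precede itself.
  rank : Fin m → Fin m
  rank i = fromℕ< (count-bound {f = λ j → M (a i) (b j)} i (a≁b i))

  rank-mono : ∀ {i j} → M (a i) (b j) ≡ true → toℕ (rank j) < toℕ (rank i)
  rank-mono {i} {j} i~j = subst₂ _<_ (≡-sym (Fin.toℕ-fromℕ< _)) (≡-sym (Fin.toℕ-fromℕ< _))
    (count-strict (λ k j~k → chain i~j j~k) j (a≁b j) i~j)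

  rank-injective : Injective rank
  rank-injective {i} {j} eq with i Fin.≟ j
  ... | yes i≡j = i≡j
  ... | no i≢j with connex i≢j
  ...   | inj₁ i~j = contradiction (rank-mono i~j) (ℕ.<-irrefl (cong toℕ (≡-sym eq)))
  ...   | inj₂ j~i = contradiction (rank-mono j~i) (ℕ.<-irrefl (cong toℕ eq))

  rank-cancel : ∀ {i j} → toℕ (rank j) < toℕ (rank i) → M (a i) (b j) ≡ true
  rank-cancel {i} {j} j<i with i Fin.≟ j
  ... | yes refl = contradiction j<i (ℕ.<-irrefl refl)
  ... | no i≢j with connex i≢j
  ...   | inj₁ i~j = i~j
  ...   | inj₂ j~i = contradiction (rank-mono j~i) (ℕ.<-asym j<i)

  rank-surjective : ∀ i → ∃[ j ] rank j ≡ i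
  rank-surjective = injective⇒surjective rank rank-injective

  lo hi : Bool
  lo = anyᵇ λ i → M y (a i)
  hi = anyᵇ λ i → M x (b i)

  y~a : ∀ i → M y (a i) ≡ lo ∧ first (rank i)
  y~a i = bool-ext
    (λ low → ∧-intro (anyᵇ-complete i low) (allᵇ-complete λ k → ≤⇒≤ᵇ (below low k)))
    (λ both → let lo-true , is-first = ∧-elim {lo} both
                  j , low = anyᵇ-sound lo-true
              in subst (λ j → M y (a j) ≡ true) (unique is-first low) low)
    where
    below : M y (a i) ≡ true → ∀ k → toℕ (rank i) ≤ toℕ k
    below low k with rank-surjective k
    ... | j , refl with i Fin.≟ j
    ...   | yes refl = ℕ.≤-refl
    ...   | no i≢j   = ℕ.<⇒≤ (rank-mono (lowest low i≢j))
    unique : ∀ {j} → first (rank i) ≡ true → M y (a j) ≡ true → j ≡ i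
    unique {j} is-first low with j Fin.≟ i
    ... | yes j≡i = j≡i
    ... | no j≢i  = contradiction (rank-mono (lowest low j≢i))
                      (ℕ.≤⇒≯ (≤ᵇ⇒≤ (allᵇ-sound is-first (rank j))))

  x~b : ∀ i → M x (b i) ≡ hi ∧ last (rank i)
  x~b i = bool-ext
    (λ high → ∧-intro (anyᵇ-complete i high) (allᵇ-complete λ k → ≤⇒≤ᵇ (above high k)))
    (λ both → let hi-true , is-last = ∧-elim {hi} both
                  j , high = anyᵇ-sound hi-true
              in subst (λ j → M x (b j) ≡ true) (unique is-last high) high)
    where
    above : M x (b i) ≡ true → ∀ k → toℕ k ≤ toℕ (rank i)
    above high k with rank-surjective k
    ... | j , refl with i Fin.≟ j
    ...   | yes refl = ℕ.≤-refl
    ...   | no i≢j   = ℕ.<⇒≤ (rank-mono (highest high i≢j))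
    unique : ∀ {j} → last (rank i) ≡ true → M x (b j) ≡ true → j ≡ i
    unique {j} is-last high with j Fin.≟ i
    ... | yes j≡i = j≡i
    ... | no j≢i  = contradiction (rank-mono (highest high j≢i))
                      (ℕ.≤⇒≯ (≤ᵇ⇒≤ (allᵇ-sound is-last (rank j))))

  a~b : ∀ i j → M (a i) (b j) ≡ (toℕ (rank j) <ᵇ toℕ (rank i))
  a~b i j = bool-ext (<⇒<ᵇ ∘ rank-mono) (rank-cancel ∘ <ᵇ⇒<)

  sorted : ∀ u v → M u v ≡ half m lo hi (mapLab rank u) (mapLab rank v)
  sorted x     x     = x≁x
  sorted x     y     = x~y
  sorted x     (a i) = x~a i
  sorted x     (b i) = x~b i
  sorted y     x     = trans (symm _ _) x~y
  sorted y     y     = y≁y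
  sorted y     (a i) = y~a i
  sorted y     (b i) = y~b i
  sorted (a i) x     = trans (symm _ _) (x~a i)
  sorted (a i) y     = trans (symm _ _) (y~a i)
  sorted (a i) (a j) = a≁a i j
  sorted (a i) (b j) = a~b i j
  sorted (b i) x     = trans (symm _ _) (x~b i)
  sorted (b i) y     = trans (symm _ _) (y~b i)
  sorted (b i) (a j) = trans (symm _ _) (a~b j i)
  sorted (b i) (b j) = b≁b i j

  unrank : Fin m → Fin m
  unrank i = proj₁ (rank-surjective i)

  unrank-injective : Injective unrank
  unrank-injective {i} {j} eq =
    trans (≡-sym (proj₂ (rank-surjective i))) (trans (cong rank eq) (proj₂ (rank-surjective j)))

  unsorted : ∀ u v → M (mapLab unrank u) (mapLab unrank v) ≡ half m lo hi u v
  unsorted u v = trans (sorted _ _) (cong₂ (half m lo hi) (back u) (back v))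
    where
    back : ∀ u → mapLab rank (mapLab unrank u) ≡ u
    back x     = refl
    back y     = refl
    back (a i) = cong a (proj₂ (rank-surjective i))
    back (b i) = cong b (proj₂ (rank-surjective i))

-- Classification

isFree : ∀ {m} → (Lab m → Lab m → Bool) → Fin m → Bool
isFree M i = free (kindOf M i)

module TripleFacts {m} {M : Lab m → Lab m → Bool} (N : Normal M) (noAtom : ¬ Atom M) where
  open Normal N
  open System system
  open SystemFacts system
  open NormalFacts N noAtom

  module _ {i j k : Fin m} (i≢j : i ≢ j) (i≢k : i ≢ k) (j≢k : j ≢ k) where
    private
      kᵢ = kindOf M i
      kⱼ = kindOf M j
      kₖ = kindOf M k
      cᵢⱼ = crossOf M i j
      cᵢₖ = crossOf M i k
      cⱼₖ = crossOf M j k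
      formed = ∧-elim {orderly kᵢ kⱼ kₖ cᵢⱼ cᵢₖ cⱼₖ} (well-formed i≢j i≢k j≢k)
      formed₁ = ∧-elim {notLonely kᵢ kⱼ kₖ} (proj₂ formed)
      formed₂ = ∧-elim {bb-joined kᵢ kⱼ cᵢⱼ} (proj₂ formed₁)
      formed₃ = ∧-elim {not (free kᵢ) ∧ not (free kⱼ) ∧ not (free kₖ) ⇒ detached (model-at i≢j i≢k j≢k)}
                       (proj₂ formed₂)
      formed₄ = ∧-elim {alternating kᵢ kⱼ kₖ cᵢⱼ cᵢₖ} (proj₂ formed₃)

    ordered-triple : isFree M i ≡ true → isFree M j ≡ true → isFree M k ≡ true →
      M (a i) (a j) ≡ false × M (b i) (b j) ≡ false × M (b i) (a j) ≡ not (M (a i) (b j)) ×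
      (M y (a i) ≡ true → M (b i) (a j) ≡ true) × (M x (b i) ≡ true → M (a i) (b j) ≡ true) ×
      (M (a i) (b j) ≡ true → M (a j) (b k) ≡ true → M (a i) (b k) ≡ true)
    ordered-triple fᵢ fⱼ fₖ =
      let all = ⇒-elim (proj₁ formed) (∧-intro fᵢ (∧-intro fⱼ fₖ))
          aa , all₁ = ∧-elim {not (M (a i) (a j))} all
          bb , all₂ = ∧-elim {not (M (b i) (b j))} all₁
          ba , all₃ = ∧-elim {M (b i) (a j) == not (M (a i) (b j))} all₂
          low , all₄ = ∧-elim {M y (a i) ⇒ M (b i) (a j)} all₃
          high , chain = ∧-elim {M x (b i) ⇒ M (a i) (b j)} all₄
      in not-true aa , not-true bb , ==-sound ba , ⇒-elim low , ⇒-elim high ,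
         λ i~j j~k → ⇒-elim chain (∧-intro i~j j~k)

    not-lonely : isFree M i ≡ false → isFree M j ≡ true → isFree M k ≢ true
    not-lonely fᵢ fⱼ fₖ = true≢false
      (∧-intro (not-false fᵢ) (∧-intro fⱼ fₖ)) (not-true (proj₁ formed₁))

    bb-edge : isFree M i ≡ false → isFree M j ≡ false → M (b i) (b j) ≡ true
    bb-edge fᵢ fⱼ = ⇒-elim (proj₁ formed₂) (∧-intro (not-false fᵢ) (not-false fⱼ))

    detached-triple : isFree M i ≡ false → isFree M j ≡ false → isFree M k ≡ false →
                      detached (model-at i≢j i≢k j≢k) ≡ true
    detached-triple fᵢ fⱼ fₖ = ⇒-elim (proj₁ formed₃)
      (∧-intro (not-false fᵢ) (∧-intro (not-false fⱼ) (not-false fₖ)))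

    alternate : isFree M i ≡ true → isFree M j ≡ false → isFree M k ≡ false →
                M (a i) (b j) ≡ not (M (a i) (b k))
    alternate fᵢ fⱼ fₖ = ==-sound (⇒-elim (proj₁ formed₄)
      (∧-intro fᵢ (∧-intro (not-false fⱼ) (not-false fₖ))))

    sporadic-triple : isFree M i ≡ true → isFree M j ≡ false → isFree M k ≡ false → M (a i) (b j) ≡ true →
                      ∀ u v → model-at i≢j i≢k j≢k u v ≡ sporadic₃ u v
    sporadic-triple fᵢ fⱼ fₖ i~j = same-sound (⇒-elim (proj₂ formed₄)
      (∧-intro fᵢ (∧-intro (not-false fⱼ) (∧-intro (not-false fₖ) i~j))))

  module _ (3≤m : 3 ≤ m) where

    third : ∀ i j → ∃[ k ] (i ≢ k × j ≢ k)
    third i j = let k , fresh = missed-value 3≤m (lookup (i ∷ j ∷ [])) in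
                k , fresh zero , fresh (suc zero)

    -- `orderly` speaks of triples, so a fact about two pairs is read off after adding an arbitrary
    -- third one; this is what `3 ≤ m` is for.
    free⇒ordered : (∀ i → isFree M i ≡ true) → Ordered M
    free⇒ordered all-free = record
      { symm = symm ; x≁x = irr x ; y≁y = irr y ; x~y = x~y ; x~a = x~a
      ; y~b = all-free ; a≁a = aa ; b≁b = bb ; a≁b = a≁b ; connex = connex ; chain = chain
      ; lowest = λ low i≢j → trans (symm _ _) (proj₁ (proj₂ (proj₂ (proj₂ (pair i≢j)))) low)
      ; highest = λ high i≢j → proj₁ (proj₂ (proj₂ (proj₂ (proj₂ (pair i≢j))))) high }
      where
      triple : ∀ {i j k} → i ≢ j → i ≢ k → j ≢ k → _
      triple {i} {j} {k} i≢j i≢k j≢k = ordered-triple i≢j i≢k j≢k (all-free i) (all-free j) (all-free k)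
      pair : ∀ {i j} (i≢j : i ≢ j) → _
      pair {i} {j} i≢j = let k , i≢k , j≢k = third i j in triple i≢j i≢k j≢k
      aa : ∀ i j → M (a i) (a j) ≡ false
      aa i j with i Fin.≟ j
      ... | yes refl = irr (a i)
      ... | no i≢j = proj₁ (pair i≢j)
      bb : ∀ i j → M (b i) (b j) ≡ false
      bb i j with i Fin.≟ j
      ... | yes refl = irr (b i)
      ... | no i≢j = proj₁ (proj₂ (pair i≢j))
      opposed : ∀ {i j} → i ≢ j → M (a j) (b i) ≡ not (M (a i) (b j))
      opposed i≢j = trans (symm _ _) (proj₁ (proj₂ (proj₂ (pair i≢j))))
      connex : ∀ {i j} → i ≢ j → M (a i) (b j) ≡ true ⊎ M (a j) (b i) ≡ true
      connex {i} {j} i≢j with M (a i) (b j) in eq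
      ... | true  = inj₁ refl
      ... | false = inj₂ (trans (opposed i≢j) (not-false eq))
      chain : ∀ {i j k} → M (a i) (b j) ≡ true → M (a j) (b k) ≡ true → M (a i) (b k) ≡ true
      chain {i} {j} {k} i~j j~k with i Fin.≟ j | j Fin.≟ k | i Fin.≟ k
      ... | yes refl | _        | _        = j~k
      ... | no _     | yes refl | _        = i~j
      ... | no i≢j   | no j≢k   | no i≢k   = proj₂ (proj₂ (proj₂ (proj₂ (proj₂ (triple i≢j i≢k j≢k))))) i~j j~k
      ... | no i≢j   | no _     | yes refl =
        contradiction (trans (opposed i≢j) (cong not i~j)) (true≢false j~k)

  -- Suppose pair i is not free and take three others. Two free ones among them leave i lonely;
  -- exactly one contradicts alternation; with none, the four b's are pairwise adjacent.
  four⇒free : 4 ≤ m → ∀ i → isFree M i ≡ true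
  four⇒free 4≤m i = ≢false⇒true λ fᵢ →
    let j , ∉₁ = missed-value 2≤m (lookup (i ∷ []))
        k , ∉₂ = missed-value 3≤m (lookup (i ∷ j ∷ []))
        l , ∉₃ = missed-value 4≤m (lookup (i ∷ j ∷ k ∷ []))
    in refute fᵢ (∉₁ zero) (∉₂ zero) (∉₃ zero) (∉₂ (suc zero)) (∉₃ (suc zero)) (∉₃ (suc (suc zero)))
         (isFree M j) refl (isFree M k) refl (isFree M l) refl
    where
    3≤m : 3 ≤ m
    3≤m = ℕ.≤-trans (ℕ.n≤1+n 3) 4≤m
    2≤m : 2 ≤ m
    2≤m = ℕ.≤-trans (ℕ.n≤1+n 2) 3≤m
    -- The edges from a j select exactly one of any two of b i, b k, b l.
    clash : ∀ {i j k l} → isFree M j ≡ true →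
            isFree M i ≡ false → isFree M k ≡ false → isFree M l ≡ false →
            j ≢ i → j ≢ k → j ≢ l → i ≢ k → i ≢ l → k ≢ l → i ≡ j
    clash {i} {j} {k} {l} fⱼ fᵢ fₖ fₗ j≢i j≢k j≢l i≢k i≢l k≢l =
      pick (M (a j) (b i)) (M (a j) (b k)) (M (a j) (b l))
        (alternate j≢i j≢k i≢k fⱼ fᵢ fₖ) (alternate j≢i j≢l i≢l fⱼ fᵢ fₗ) (alternate j≢k j≢l k≢l fⱼ fₖ fₗ)
      where
      pick : ∀ {A : Set} α β γ → α ≡ not β → α ≡ not γ → β ≡ not γ → A
      pick true  false false _  _  ()
      pick false true  true  _  _  ()
      pick true  true  _     () _  _
      pick false false _     () _  _
      pick true  false true  _  () _
      pick false true  false _  () _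
    refute : ∀ {j k l} → isFree M i ≡ false → i ≢ j → i ≢ k → i ≢ l → j ≢ k → j ≢ l → k ≢ l →
             ∀ β → isFree M j ≡ β → ∀ γ → isFree M k ≡ γ → ∀ δ → isFree M l ≢ δ
    refute fᵢ i≢j i≢k i≢l j≢k j≢l k≢l true fⱼ true fₖ _ _ = not-lonely i≢j i≢k j≢k fᵢ fⱼ fₖ
    refute fᵢ i≢j i≢k i≢l j≢k j≢l k≢l true fⱼ false fₖ true fₗ = not-lonely i≢j i≢l j≢l fᵢ fⱼ fₗ
    refute fᵢ i≢j i≢k i≢l j≢k j≢l k≢l false fⱼ true fₖ true fₗ = not-lonely i≢k i≢l k≢l fᵢ fₖ fₗ
    refute fᵢ i≢j i≢k i≢l j≢k j≢l k≢l true fⱼ false fₖ false fₗ =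
      i≢j (clash fⱼ fᵢ fₖ fₗ (i≢j ∘ ≡-sym) j≢k j≢l i≢k i≢l k≢l)
    refute fᵢ i≢j i≢k i≢l j≢k j≢l k≢l false fⱼ true fₖ false fₗ =
      i≢k (clash fₖ fᵢ fⱼ fₗ (i≢k ∘ ≡-sym) (j≢k ∘ ≡-sym) k≢l i≢j i≢l j≢l)
    refute fᵢ i≢j i≢k i≢l j≢k j≢l k≢l false fⱼ false fₖ true fₗ =
      i≢l (clash fₗ fᵢ fⱼ fₖ (i≢l ∘ ≡-sym) (j≢l ∘ ≡-sym) (k≢l ∘ ≡-sym) i≢j i≢k j≢k)
    -- The b's form a complete graph on four vertices: `b l` serves for all vertices of colour 0 and
    -- `b k` for both of colour 1.
    refute {j} {k} {l} fᵢ i≢j i≢k i≢l j≢k j≢l k≢l false fⱼ false fₖ false fₗ = noAtom record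
      { r = b i ; u₂ = b j ; u₁ = b k ; w₁ = b k ; u₀ = b l ; w₀ = b l ; z = b l ; t = b l
      ; r~u₂ = bb-edge i≢j i≢k j≢k fᵢ fⱼ ; r~u₁ = bb-edge i≢k i≢j (j≢k ∘ ≡-sym) fᵢ fₖ
      ; u₂~w₁ = bb-edge j≢k j≢l k≢l fⱼ fₖ ; r~u₀ = bb-edge i≢l i≢j (j≢l ∘ ≡-sym) fᵢ fₗ
      ; u₂~w₀ = bb-edge j≢l j≢k (k≢l ∘ ≡-sym) fⱼ fₗ
      ; u₁~z = bb-edge k≢l (j≢k ∘ ≡-sym) (j≢l ∘ ≡-sym) fₖ fₗ
      ; w₁~t = bb-edge k≢l (j≢k ∘ ≡-sym) (j≢l ∘ ≡-sym) fₖ fₗ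
      ; u₁≁w₁ = irr _ ; u₀≁w₀ = irr _ ; u₀≁z = irr _ ; u₀≁t = irr _
      ; w₀≁z = irr _ ; w₀≁t = irr _ ; z≁t = irr _ }

-- A path from `b zero` to x would have to leave the b's. The successor in the index supplies
-- `b zero`.
detached⇒disconnected : ∀ {m} {G} {M : Lab (suc m) → Lab (suc m) → Bool} →
                        G ≃ M → detached M ≡ true → ¬ Connected G
detached⇒disconnected {m} {G} {M} (size , ℓ , ℓ-inj , edges) det conn = outside (stay (conn (ℓ (b zero)) (ℓ x)) (b zero , refl , refl))
  where
  Inside : Fin (n G) → Set
  Inside v = ∃[ u ] (ℓ u ≡ v × onB u ≡ true)
  outside : ¬ Inside (ℓ x)
  outside (u , eq , in-b) with ℓ-inj eq
  outside (.x , eq , ()) | refl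
  stay : ∀ {v w} → Reach G v w → Inside v → Inside w
  stay here v∈ = v∈
  stay (step {v = w} v~w path) (u , refl , in-b) =
    let u′ , eq = labelling-surjective size ℓ ℓ-inj w
        u~u′ = trans (≡-sym (edges u u′)) (subst (λ w → E G (ℓ u) w ≡ true) (≡-sym eq) v~w)
    in stay path (u′ , eq , ⇒-elim (allLab-sound (allLab-sound det u) u′) (∧-intro in-b u~u′))

twoSided⇒2-colorable : ∀ {m} {G} {M : Lab m → Lab m → Bool} → G ≃ M →
  (∀ u v → M u v ≡ true → xSide u ≡ not (xSide v)) → HasProperColoring G 2
twoSided⇒2-colorable {m} {G} {M} (size , ℓ , ℓ-inj , edges) sides = c , proper
  where
  side : Bool → Fin 2
  side β = if β then zero else suc zero
  side-not : ∀ β → side (not β) ≢ side β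
  side-not true  ()
  side-not false ()
  name : ∀ v → ∃[ u ] ℓ u ≡ v
  name = labelling-surjective size ℓ ℓ-inj
  c : Fin (n G) → Fin 2
  c v = side (xSide (proj₁ (name v)))
  proper : Proper G c
  proper v w v~w eq = side-not (xSide (proj₁ (name w))) (trans (cong side (≡-sym (sides _ _ edge))) eq)
    where
    edge : M (proj₁ (name v)) (proj₁ (name w)) ≡ true
    edge = trans (≡-sym (edges _ _)) (trans (cong₂ (E G) (proj₂ (name v)) (proj₂ (name w))) v~w)

≃-half : ∀ {m} {G} {M : Lab m → Lab m → Bool} → ¬ HasProperColoring G 2 → Ordered M → G ≃ M →
         G ≃ half m true false ⊎ G ≃ half m true true
≃-half {m} {G} not-2 O G≃M = decide (Sorting.lo O) refl (Sorting.hi O) refl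
  where
  sort : ∀ {M} (O : Ordered M) → G ≃ M → ∀ {lo hi} → Sorting.lo O ≡ lo → Sorting.hi O ≡ hi → G ≃ half m lo hi
  sort O G≃M refl refl =
    ≃-cong {G = G} unsorted (≃-relabel {G = G} (mapLab unrank) (mapLab-injective unrank-injective) G≃M)
    where open Sorting O
  bipartite : ∀ u v → half m false false u v ≡ true → xSide u ≡ not (xSide v)
  bipartite x     y     _ = refl
  bipartite x     (a _) _ = refl
  bipartite y     x     _ = refl
  bipartite y     (b _) _ = refl
  bipartite (a _) x     _ = refl
  bipartite (a _) (b _) _ = refl
  bipartite (b _) y     _ = refl
  bipartite (b _) (a _) _ = refl
  decide : ∀ lo → Sorting.lo O ≡ lo → ∀ hi → Sorting.hi O ≡ hi → _
  decide true  lo≡ false hi≡ = inj₁ (sort O G≃M lo≡ hi≡)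
  decide true  lo≡ true  hi≡ = inj₂ (sort O G≃M lo≡ hi≡)
  -- For the reversed order `Sorting.lo` computes to the former `Sorting.hi` and conversely, so the
  -- two equations change places.
  decide false lo≡ true  hi≡ =
    inj₁ (sort (reversed O) (≃-relabel {G = G} reversal reversal-injective G≃M) hi≡ lo≡)
  decide false lo≡ false hi≡ = contradiction (twoSided⇒2-colorable {G = G} (sort O G≃M lo≡ hi≡) bipartite) not-2

module Classify (G : Graph) (connected : Connected G) (not-2 : ¬ HasProperColoring G 2)
                (noAtom : ¬ Atom (E G)) where

  no-atom : ∀ {m} {M : Lab m → Lab m → Bool} → G ≃ M → ¬ Atom M
  no-atom (_ , ℓ , _ , edges) A = noAtom (atom-pullback ℓ edges A)

  classify₂ : {M : Lab 2 → Lab 2 → Bool} → Normal M → G ≃ M → ∃[ i ] G ≃ lookup catalogue₂ i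
  classify₂ {M} N G≃M = sort (∨-elim {detached M₂} (proj₂ (∧-elim {compatible k₀ k₁ c} (checked₂ 0≢1))))
    where
    open NormalFacts N (no-atom {M = M} G≃M)
    0≢1 : Fin.zero {1} ≢ suc zero
    0≢1 ()
    k₀ = kindOf M zero
    k₁ = kindOf M (suc zero)
    c = crossOf M zero (suc zero)
    M₂ = model₂ k₀ k₁ c
    G≃M₂ : G ≃ M₂
    G≃M₂ = ≃-cong {G = G} (submodel₂ 0≢1) (≃-relabel {G = G} (mapLab (embed₂ 0≢1)) (mapLab-injective inj) G≃M)
      where
      inj : Injective (embed₂ 0≢1)
      inj {zero} {zero} _ = refl
      inj {zero} {suc zero} ()
      inj {suc zero} {zero} ()
      inj {suc zero} {suc zero} _ = refl
    sort : _ → ∃[ i ] G ≃ lookup catalogue₂ i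
    sort (inj₁ det) = contradiction connected (detached⇒disconnected {G = G} G≃M₂ det)
    sort (inj₂ rest) with ∨-elim {twoSided M₂} rest
    ... | inj₁ two = contradiction (twoSided⇒2-colorable {G = G} G≃M₂
            λ u v u~v → ==-sound (⇒-elim (allLab-sound (allLab-sound two u) v) u~v)) not-2
    ... | inj₂ found =
      let i , found′ = anyᵇ-sound found
          σ , match  = anyBits-sound 4 found′
      in i , ≃-cong {G = G} (same-sound match) (≃-relabel {G = G} (relabel₂ σ) (relabel₂-injective σ) G≃M₂)

  classify₃ : {M : Lab 3 → Lab 3 → Bool} → Normal M → G ≃ M →
              G ≃ half 3 true false ⊎ G ≃ half 3 true true ⊎ G ≃ sporadic₃
  classify₃ {M} N G≃M = decide _ refl _ refl _ refl
    where
    open NormalFacts N (no-atom {M = M} G≃M)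
    open TripleFacts N (no-atom {M = M} G≃M)
    p q r : Fin 3
    p = zero
    q = suc zero
    r = suc (suc zero)
    at : ∀ {i j k} (i≢j : i ≢ j) (i≢k : i ≢ k) (j≢k : j ≢ k) → G ≃ model-at i≢j i≢k j≢k
    at i≢j i≢k j≢k = ≃-cong {G = G} (submodel₃ i≢j i≢k j≢k)
      (≃-relabel {G = G} (mapLab (embed₃ i≢j i≢k j≢k)) (mapLab-injective (embed₃-injective i≢j i≢k j≢k)) G≃M)
    lonely : ∀ {A : Set} {i j k} → i ≢ j → i ≢ k → j ≢ k →
             isFree M i ≡ false → isFree M j ≡ true → isFree M k ≡ true → A
    lonely i≢j i≢k j≢k fᵢ fⱼ fₖ = contradiction fₖ (not-lonely i≢j i≢k j≢k fᵢ fⱼ)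
    sporadic : ∀ {i j k} → i ≢ j → i ≢ k → j ≢ k →
               isFree M i ≡ true → isFree M j ≡ false → isFree M k ≡ false → G ≃ sporadic₃
    sporadic {i} {j} {k} i≢j i≢k j≢k fᵢ fⱼ fₖ with M (a i) (b j) in eq
    ... | true  = ≃-cong {G = G} (sporadic-triple i≢j i≢k j≢k fᵢ fⱼ fₖ eq) (at i≢j i≢k j≢k)
    -- By `alternate`, a i is then joined to b k, so exchanging j and k leads to `sporadic₃`.
    ... | false = ≃-cong {G = G} (sporadic-triple i≢k i≢j (j≢k ∘ ≡-sym) fᵢ fₖ fⱼ
                    (trans (alternate i≢k i≢j (j≢k ∘ ≡-sym) fᵢ fₖ fⱼ) (not-false eq)))
                    (at i≢k i≢j (j≢k ∘ ≡-sym))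
    decide : ∀ α → isFree M p ≡ α → ∀ β → isFree M q ≡ β → ∀ γ → isFree M r ≡ γ → _
    decide true fp true fq true fr
      with ≃-half {G = G} not-2 (free⇒ordered ℕ.≤-refl λ { zero → fp ; (suc zero) → fq ; (suc (suc zero)) → fr }) G≃M
    ... | inj₁ G≃ = inj₁ G≃
    ... | inj₂ G≃ = inj₂ (inj₁ G≃)
    decide true  fp true  fq false fr = lonely {i = r} {p} {q} (λ ()) (λ ()) (λ ()) fr fp fq
    decide true  fp false fq true  fr = lonely {i = q} {p} {r} (λ ()) (λ ()) (λ ()) fq fp fr
    decide false fp true  fq true  fr = lonely {i = p} {q} {r} (λ ()) (λ ()) (λ ()) fp fq fr
    decide true  fp false fq false fr = inj₂ (inj₂ (sporadic {p} {q} {r} (λ ()) (λ ()) (λ ()) fp fq fr))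
    decide false fp true  fq false fr = inj₂ (inj₂ (sporadic {q} {p} {r} (λ ()) (λ ()) (λ ()) fq fp fr))
    decide false fp false fq true  fr = inj₂ (inj₂ (sporadic {r} {p} {q} (λ ()) (λ ()) (λ ()) fr fp fq))
    decide false fp false fq false fr = contradiction connected (detached⇒disconnected
      (at {p} {q} {r} (λ ()) (λ ()) (λ ())) (detached-triple {p} {q} {r} (λ ()) (λ ()) (λ ()) fp fq fr))

  classify₄ : ∀ {m} → 4 ≤ m → {M : Lab m → Lab m → Bool} → Normal M → G ≃ M →
              G ≃ half m true false ⊎ G ≃ half m true true
  classify₄ 4≤m {M} N G≃M = ≃-half {G = G} not-2 (free⇒ordered (ℕ.≤-trans (ℕ.n≤1+n 3) 4≤m) (four⇒free 4≤m)) G≃M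
    where open TripleFacts N (no-atom {M = M} G≃M)

-- The extremal graphs

labGraph : ∀ {m} {M : Lab m → Lab m → Bool} → System M → Graph
labGraph {m} {M} S = record
  { n = 2 + (m + m)
  ; E = λ u v → M (decode u) (decode v)
  ; sym = λ u v → System.symm S (decode u) (decode v)
  ; irrefl = λ v → System.irr S (decode v) }

≃⇒≅ : ∀ {m} {G} {M : Lab m → Lab m → Bool} (S : System M) → G ≃ M → G ≅ labGraph S
≃⇒≅ {m} {G} {M} S (size , ℓ , ℓ-inj , edges) = record
  { to = λ v → encode (name v)
  ; from = λ i → ℓ (decode i)
  ; from-to = λ v → trans (cong ℓ (decode-encode (name v))) (ℓ-name v)
  ; to-from = λ i → trans (cong encode (ℓ-inj (ℓ-name (ℓ (decode i))))) (encode-decode {m} i)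
  ; preserve = λ u v → trans (cong₂ M (decode-encode (name u)) (decode-encode (name v)))
      (trans (≡-sym (edges (name u) (name v))) (cong₂ (E G) (ℓ-name u) (ℓ-name v))) }
  where
  name : Fin (n G) → Lab m
  name v = proj₁ (labelling-surjective size ℓ ℓ-inj v)
  ℓ-name : ∀ v → ℓ (name v) ≡ v
  ℓ-name v = proj₂ (labelling-surjective size ℓ ℓ-inj v)

complete-size : ∀ {G} → ¬ Atom (E G) → ∀ {m} → 2 ≤ m → HasCompleteColoring G (2 + m) → 2 + (m + m) ≤ n G
complete-size {G} noAtom 2≤m coloring = Classes.size G noAtom 2≤m coloring

-- Conditions that give admissibility: `linked` leads from every vertex to x or y in two steps,
-- `triangle` bounds both the chromatic and the Grundy number from below, and the complete coloring
-- is contained in `system`.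
record Suitable {m : ℕ} (M : Lab m → Lab m → Bool) : Set where
  field
    system   : System M
    linked   : ∀ v → ∃[ u ] (M v u ≡ true × (M u x ≡ true ⊎ M u y ≡ true))
    triangle : ∃[ u ] ∃[ v ] ∃[ w ] (M u v ≡ true × M u w ≡ true × M v w ≡ true)
    bounded  : ∀ {k} → HasGrundyColoring (labGraph system) k → k ≤ 3

  graph : Graph
  graph = labGraph system

3-colours-needed : ∀ {G u v w} → Adj G u v → Adj G u w → Adj G v w → ∀ k → HasProperColoring G k → 3 ≤ k
3-colours-needed {G} {u} {v} {w} u~v u~w v~w k (c , proper) =
  Fin.injective⇒≤ {f = lookup (c u ∷ c v ∷ c w ∷ [])} λ
    { {zero} {zero} _ → refl
    ; {zero} {suc zero} eq → contradiction eq (proper _ _ u~v)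
    ; {zero} {suc (suc zero)} eq → contradiction eq (proper _ _ u~w)
    ; {suc zero} {zero} eq → contradiction (≡-sym eq) (proper _ _ u~v)
    ; {suc zero} {suc zero} _ → refl
    ; {suc zero} {suc (suc zero)} eq → contradiction eq (proper _ _ v~w)
    ; {suc (suc zero)} {zero} eq → contradiction (≡-sym eq) (proper _ _ u~w)
    ; {suc (suc zero)} {suc zero} eq → contradiction (≡-sym eq) (proper _ _ v~w)
    ; {suc (suc zero)} {suc (suc zero)} _ → refl }

-- The Grundy coloring grown from the triangle has exactly three colours by `bounded`, so it also
-- serves as the proper 3-coloring. More than 2 + m colours in a complete coloring would need more
-- than 2 + 2m vertices.
suitable⇒admissible : ∀ {m} → 2 ≤ m → {M : Lab m → Lab m → Bool} (U : Suitable M) →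
                      Admissible (2 + m) (Suitable.graph U)
suitable⇒admissible {m} 2≤m {M} U =
  connected ,
  ((proj₁ grundy₃ , proj₁ (proj₂ grundy₃)) , 3-colours-needed {G} {encode tu} {encode tv} {encode tw} e₁ e₂ e₃) ,
  (grundy₃ , λ _ → bounded) ,
  (colour ∘ decode , complete-colouring) , at-most
  where
  open Suitable U
  open System system
  open SystemFacts system using (x~y)
  G = graph
  adj : ∀ {u v} → M u v ≡ true → Adj G (encode u) (encode v)
  adj {u} {v} u~v = trans (cong₂ M (decode-encode u) (decode-encode v)) u~v
  hop : ∀ {u v w} → M u v ≡ true → Reach G (encode v) w → Reach G (encode u) w
  hop {u} {v} u~v = step {v = encode v} (adj u~v)
  reach-x : ∀ v → Reach G (encode v) (encode {m} x)
  reach-x v with linked v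
  ... | u , v~u , inj₁ u~x = hop v~u (hop u~x here)
  ... | u , v~u , inj₂ u~y = hop v~u (hop u~y (hop (trans (symm y x) x~y) here))
  join-reach : ∀ {u v w} → Reach G u v → Reach G v w → Reach G u w
  join-reach here       q = q
  join-reach (step e p) q = step e (join-reach p q)
  reverse-reach : ∀ {u v} → Reach G u v → Reach G v u
  reverse-reach here = here
  reverse-reach (step {u} {v} e p) = join-reach (reverse-reach p) (step (trans (symm _ _) e) here)
  connected : Connected G
  connected u v = subst₂ (Reach G) (encode-decode {m} u) (encode-decode {m} v)
    (join-reach (reach-x (decode u)) (reverse-reach (reach-x (decode v))))
  tu = proj₁ triangle
  tv = proj₁ (proj₂ triangle)
  tw = proj₁ (proj₂ (proj₂ triangle))
  e₁ : Adj G (encode tu) (encode tv)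
  e₁ = adj (proj₁ (proj₂ (proj₂ (proj₂ triangle))))
  e₂ : Adj G (encode tu) (encode tw)
  e₂ = adj (proj₁ (proj₂ (proj₂ (proj₂ (proj₂ triangle)))))
  e₃ : Adj G (encode tv) (encode tw)
  e₃ = adj (proj₂ (proj₂ (proj₂ (proj₂ (proj₂ triangle)))))
  grundy₃ : HasGrundyColoring G 3
  grundy₃ = let k , 2<k , grundy = Greedy.triangle⇒grundy G {encode tu} {encode tv} {encode tw} e₁ e₂ e₃ in
    subst (HasGrundyColoring G) (ℕ.≤-antisym (bounded grundy) 2<k) grundy
  complete-colouring : IsComplete G (colour ∘ decode)
  complete-colouring =
    (λ u v → proper (decode u) (decode v)) ,
    (λ { zero → hit zero (suc zero) (λ ()) ; (suc i) → hit (suc i) zero (λ ()) }) ,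
    λ i j i≢j → let u , v , u~v , cu , cv = complete i≢j in
      encode u , encode v , adj u~v , trans (cong colour (decode-encode u)) cu ,
      trans (cong colour (decode-encode v)) cv
    where
    hit : ∀ i j → i ≢ j → ∃[ v ] colour (decode {m} v) ≡ i
    hit i j i≢j = let u , _ , _ , cu , _ = complete i≢j in
      encode u , trans (cong colour (decode-encode u)) cu
  noAtom : ¬ Atom (E G)
  noAtom A = let k , 3<k , grundy = Greedy.atom⇒grundy G A in contradiction (bounded grundy) (ℕ.<⇒≱ 3<k)
  at-most : ∀ k → HasCompleteColoring G k → k ≤ 2 + m
  at-most zero _ = z≤n
  at-most (suc zero) _ = s≤s z≤n
  at-most (suc (suc k)) coloring with 2 ≤? k
  -- Fewer than four colours lie outside the range of the counting bound, but do not exceed 2 + m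
  -- anyway.
  ... | no ¬2≤k = s≤s (s≤s (ℕ.≤-trans (ℕ.<⇒≤ (ℕ.≰⇒> ¬2≤k)) 2≤m))
  ... | yes 2≤k with k ≤? m
  ...   | yes k≤m = s≤s (s≤s k≤m)
  ...   | no k≰m = contradiction (complete-size {G} noAtom 2≤k coloring)
                     (ℕ.<⇒≱ (s≤s (s≤s (ℕ.+-mono-< (ℕ.≰⇒> k≰m) (ℕ.≰⇒> k≰m)))))

_≡ᶠ_ : ∀ {k} → Fin k → Fin k → Bool
i ≡ᶠ j = toℕ i ≡ᵇ toℕ j

≡ᶠ-sound : ∀ {k} {i j : Fin k} → i ≡ᶠ j ≡ true → i ≡ j
≡ᶠ-sound {i = i} {j} eq = Fin.toℕ-injective (ℕ.≡ᵇ⇒≡ (toℕ i) (toℕ j) (subst T (≡-sym eq) _))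

≡ᶠ-refl : ∀ {k} (i : Fin k) → i ≡ᶠ i ≡ true
≡ᶠ-refl i with toℕ i ≡ᵇ toℕ i | ℕ.≡⇒≡ᵇ (toℕ i) (toℕ i) refl
... | true | _ = refl

module _ {m} (M : Lab m → Lab m → Bool) where

  symmetricᵇ irreflexiveᵇ properᵇ completeᵇ linkedᵇ triangleᵇ suitableᵇ : Bool
  symmetricᵇ   = same M λ u v → M v u
  irreflexiveᵇ = allLab λ u → not (M u u)
  properᵇ      = allLab λ u → allLab λ v → M u v ⇒ not (colour u ≡ᶠ colour v)
  completeᵇ    = allᵇ λ i → allᵇ λ j → i ≡ᶠ j ∨
                 (anyLab λ u → anyLab λ v → M u v ∧ colour u ≡ᶠ i ∧ colour v ≡ᶠ j)
  linkedᵇ      = allLab λ v → anyLab λ u → M v u ∧ (M u x ∨ M u y)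
  triangleᵇ    = anyLab λ u → anyLab λ v → anyLab λ w → M u v ∧ M u w ∧ M v w
  suitableᵇ    = symmetricᵇ ∧ irreflexiveᵇ ∧ properᵇ ∧ completeᵇ ∧ linkedᵇ ∧ triangleᵇ ∧ not (hasAtom M)

  suitableᵇ-sound : suitableᵇ ≡ true → Suitable M
  suitableᵇ-sound eq = record
    { system = sys ; linked = linked ; triangle = triangle ; bounded = bounded }
    where
    s₁ = ∧-elim {symmetricᵇ} eq
    s₂ = ∧-elim {irreflexiveᵇ} (proj₂ s₁)
    s₃ = ∧-elim {properᵇ} (proj₂ s₂)
    s₄ = ∧-elim {completeᵇ} (proj₂ s₃)
    s₅ = ∧-elim {linkedᵇ} (proj₂ s₄)
    s₆ = ∧-elim {triangleᵇ} (proj₂ s₅)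
    complete : ∀ {i j} → i ≢ j → ∃[ u ] ∃[ v ] (M u v ≡ true × colour u ≡ i × colour v ≡ j)
    complete {i} {j} i≢j with ∨-elim {i ≡ᶠ j} (allᵇ-sound (allᵇ-sound (proj₁ s₄) i) j)
    ... | inj₁ i≡j = contradiction (≡ᶠ-sound i≡j) i≢j
    ... | inj₂ found =
      let u , found₁ = anyLab-sound found
          v , found₂ = anyLab-sound found₁
          u~v , found₃ = ∧-elim {M u v} found₂
          cu , cv = ∧-elim {colour u ≡ᶠ i} found₃
      in u , v , u~v , ≡ᶠ-sound cu , ≡ᶠ-sound cv
    sys : System M
    sys = record
      { symm = same-sound (proj₁ s₁)
      ; irr = λ u → not-true (allLab-sound (proj₁ s₂) u)
      ; proper = λ u v u~v same-colour → true≢false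
          (subst (λ i → colour u ≡ᶠ i ≡ true) same-colour (≡ᶠ-refl (colour u)))
          (not-true (⇒-elim (allLab-sound (allLab-sound (proj₁ s₃) u) v) u~v))
      ; complete = complete }
    linked : ∀ v → ∃[ u ] (M v u ≡ true × (M u x ≡ true ⊎ M u y ≡ true))
    linked v = let u , found = anyLab-sound (allLab-sound (proj₁ s₅) v)
                   v~u , hub = ∧-elim {M v u} found
               in u , v~u , ∨-elim hub
    triangle : ∃[ u ] ∃[ v ] ∃[ w ] (M u v ≡ true × M u w ≡ true × M v w ≡ true)
    triangle = let u , found = anyLab-sound (proj₁ s₆)
                   v , found₁ = anyLab-sound found
                   w , found₂ = anyLab-sound found₁
                   u~v , found₃ = ∧-elim {M u v} found₂
                   u~w , v~w = ∧-elim {M u w} found₃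
               in u , v , w , u~v , u~w , v~w
    bounded : ∀ {k} → HasGrundyColoring (labGraph sys) k → k ≤ 3
    bounded {k} grundy with k ≤? 3
    ... | yes k≤3 = k≤3
    ... | no k≰3 = contradiction (not-true (proj₂ s₆)) (true≢false (atom⇒hasAtom M
      (atom-pullback decode (λ _ _ → refl) (Greedy.grundy⇒atom (labGraph sys) (ℕ.≰⇒> k≰3) grundy))))

opaque
  unfolding allLab

  catalogue₂-suitableᵇ : allᵇ (λ i → suitableᵇ (lookup catalogue₂ i)) ≡ true
  catalogue₂-suitableᵇ = refl

  sporadic₃-suitableᵇ : suitableᵇ sporadic₃ ≡ true
  sporadic₃-suitableᵇ = refl

catalogue₂-suitable : ∀ i → Suitable (lookup catalogue₂ i)
catalogue₂-suitable i = suitableᵇ-sound _ (allᵇ-sound catalogue₂-suitableᵇ i)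

sporadic₃-suitable : Suitable sporadic₃
sporadic₃-suitable = suitableᵇ-sound _ sporadic₃-suitableᵇ

first-≤ : ∀ {m} {i j : Fin m} → first i ≡ true → toℕ i ≤ toℕ j
first-≤ {j = j} eq = ≤ᵇ⇒≤ (allᵇ-sound eq j)

last-≤ : ∀ {m} {i j : Fin m} → last i ≡ true → toℕ j ≤ toℕ i
last-≤ {j = j} eq = ≤ᵇ⇒≤ (allᵇ-sound eq j)

first-zero : ∀ {m} → first {suc m} zero ≡ true
first-zero {m} = allᵇ-complete {f = λ j → 0 ≤ᵇ toℕ j} λ _ → refl

last-fromℕ : ∀ m → last (fromℕ m) ≡ true
last-fromℕ m = allᵇ-complete λ j → ≤⇒≤ᵇ (subst (toℕ j ≤_) (≡-sym (Fin.toℕ-fromℕ m)) (ℕ.≤-pred (Fin.toℕ<n j)))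

-- Half graphs and their Grundy number

module Half (m : ℕ) (lo hi : Bool) where

  H : Lab m → Lab m → Bool
  H = half m lo hi

  H-sym : ∀ u v → H u v ≡ H v u
  H-sym x     x     = refl
  H-sym x     y     = refl
  H-sym x     (a i) = refl
  H-sym x     (b i) = refl
  H-sym y     x     = refl
  H-sym y     y     = refl
  H-sym y     (a i) = refl
  H-sym y     (b i) = refl
  H-sym (a i) x     = refl
  H-sym (a i) y     = refl
  H-sym (a i) (a j) = refl
  H-sym (a i) (b j) = refl
  H-sym (b i) x     = refl
  H-sym (b i) y     = refl
  H-sym (b i) (a j) = refl
  H-sym (b i) (b j) = refl

  H-irr : ∀ u → H u u ≡ false
  H-irr x     = refl
  H-irr y     = refl
  H-irr (a _) = refl
  H-irr (b _) = refl

  H-proper : ∀ u v → H u v ≡ true → colour u ≢ colour v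
  H-proper x     x     ()
  H-proper x     y     _ ()
  H-proper x     (a i) _ ()
  H-proper x     (b i) _ ()
  H-proper y     y     ()
  H-proper (a i) (a j) ()
  H-proper (a i) (b .i) i<i refl = ℕ.<-irrefl refl (<ᵇ⇒< {toℕ i} i<i)
  H-proper (b i) (a .i) i<i refl = ℕ.<-irrefl refl (<ᵇ⇒< {toℕ i} i<i)
  H-proper (b i) (b j) ()

  H-complete : ∀ i j → i ≢ j → ∃[ u ] ∃[ v ] (H u v ≡ true × colour u ≡ i × colour v ≡ j)
  H-complete zero          zero          i≢j = contradiction refl i≢j
  H-complete zero          (suc zero)    _   = x , y , refl , refl , refl
  H-complete zero          (suc (suc j)) _   = x , a j , refl , refl , refl
  H-complete (suc zero)    zero          _   = y , x , refl , refl , refl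
  H-complete (suc zero)    (suc zero)    i≢j = contradiction refl i≢j
  H-complete (suc zero)    (suc (suc j)) _   = y , b j , refl , refl , refl
  H-complete (suc (suc i)) zero          _   = a i , x , refl , refl , refl
  H-complete (suc (suc i)) (suc zero)    _   = b i , y , refl , refl , refl
  H-complete (suc (suc i)) (suc (suc j)) i≢j with Fin.<-cmp i j
  ... | tri< i<j _ _ = b i , a j , <⇒<ᵇ i<j , refl , refl
  ... | tri≈ _ refl _ = contradiction refl i≢j
  ... | tri> _ _ j<i = a i , b j , <⇒<ᵇ j<i , refl , refl

  H-system : System H
  H-system = record { symm = H-sym ; irr = H-irr ; proper = H-proper ; complete = H-complete _ _ }

  H-linked : ∀ v → ∃[ u ] (H v u ≡ true × (H u x ≡ true ⊎ H u y ≡ true))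
  H-linked x     = y , refl , inj₁ refl
  H-linked y     = x , refl , inj₂ refl
  H-linked (a i) = x , refl , inj₂ refl
  H-linked (b i) = y , refl , inj₁ refl

  -- A vertex of colour 3 starts edges r u₂, r u₁ and u₂ w₁ among the vertices of positive colour,
  -- with u₁ and w₁ both of colour 1. If x or y has colour 0, all edges among positive vertices meet
  -- the other hub; otherwise the positive vertices induce a complete bipartite graph. Both exclude
  -- these three edges.
  module Bounded (col : Lab m → ℕ) (proper : ∀ {u v} → H u v ≡ true → col u ≢ col v)
                 (sees : ∀ {v} i → i < col v → ∃[ u ] (H v u ≡ true × col u ≡ i)) where

    sees-zero : ∀ {v} → col v ≢ 0 → ∃[ u ] (H v u ≡ true × col u ≡ 0)
    sees-zero v≢0 = sees 0 (ℕ.n≢0⇒n>0 v≢0)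

    both-zero : ∀ {u v} → col u ≡ 0 → col v ≡ 0 → H u v ≢ true
    both-zero u≡0 v≡0 u~v = proper u~v (trans u≡0 (≡-sym v≡0))

    module _ {r u₂ u₁ w₁ : Lab m} (r≡3 : col r ≡ 3) (u₂≡2 : col u₂ ≡ 2) (u₁≡1 : col u₁ ≡ 1) (w₁≡1 : col w₁ ≡ 1)
             (r~u₂ : H r u₂ ≡ true) (r~u₁ : H r u₁ ≡ true) (u₂~w₁ : H u₂ w₁ ≡ true) where

      positive : ∀ {v k} → col v ≡ suc k → col v ≢ 0
      positive v≡ v≡0 with trans (≡-sym v≡) v≡0
      ... | ()

      -- A centre would be r or u₂ by the first edge, but by their colours r is not on u₂ w₁ and u₂
      -- is not on r u₁.
      not-star : ∀ s → ¬ (∀ u v → H u v ≡ true → col u ≢ 0 → col v ≢ 0 → u ≡ s ⊎ v ≡ s)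
      not-star s star
        with star r u₂ r~u₂ (positive r≡3) (positive u₂≡2)
           | star r u₁ r~u₁ (positive r≡3) (positive u₁≡1)
           | star u₂ w₁ u₂~w₁ (positive u₂≡2) (positive w₁≡1)
      ... | inj₁ refl | _ | inj₁ refl = contradiction (trans (≡-sym r≡3) u₂≡2) λ ()
      ... | inj₁ refl | _ | inj₂ refl = contradiction (trans (≡-sym r≡3) w₁≡1) λ ()
      ... | inj₂ refl | inj₁ refl | _ = contradiction (trans (≡-sym r≡3) u₂≡2) λ ()
      ... | inj₂ refl | inj₂ refl | _ = contradiction (trans (≡-sym u₁≡1) u₂≡2) λ ()

      -- Three edges lead from u₁ through r and u₂ to w₁, so u₁ and w₁ lie on opposite sides and
      -- would be adjacent despite their common colour.
      not-complete-bipartite :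
        (∀ u v → H u v ≡ true → col u ≢ 0 → col v ≢ 0 → xSide u ≡ not (xSide v)) →
        ¬ (∀ u v → xSide u ≡ not (xSide v) → col u ≢ 0 → col v ≢ 0 → H u v ≡ true)
      not-complete-bipartite crossing joining = proper
        (joining u₁ w₁ opposite-sides (positive u₁≡1) (positive w₁≡1)) (trans u₁≡1 (≡-sym w₁≡1))
        where
        opposite-sides : xSide u₁ ≡ not (xSide w₁)
        opposite-sides
          rewrite ≡-sym (crossing u₂ w₁ u₂~w₁ (positive u₂≡2) (positive w₁≡1))
          = trans (crossing u₁ r (trans (H-sym u₁ r) r~u₁) (positive u₁≡1) (positive r≡3))
                  (≡-sym (crossing u₂ r (trans (H-sym u₂ r) r~u₂) (positive u₂≡2) (positive r≡3)))

    -- An edge a i ~ b j between positive vertices is excluded: b j would need a neighbour of colour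
    -- 0, but y and the a's already see x of that colour, and x sees at most the last b, whereas j <
    -- i.
    star-y : col x ≡ 0 → ∀ u v → H u v ≡ true → col u ≢ 0 → col v ≢ 0 → u ≡ y ⊎ v ≡ y
    star-y x≡0 = λ where
        x     v     _   u≢0 _   → contradiction x≡0 u≢0
        u     x     _   _   v≢0 → contradiction x≡0 v≢0
        y     v     _   _   _   → inj₁ refl
        u     y     _   _   _   → inj₂ refl
        (a i) (b j) j<i _   v≢0 → absurd {i} (<ᵇ⇒< j<i) v≢0
        (b i) (a j) i<j u≢0 _   → absurd {j} (<ᵇ⇒< i<j) u≢0
      where
      absurd : ∀ {i j} {A : Set} → toℕ j < toℕ i → col (b j) ≢ 0 → A
      absurd {i} {j} j<i b≢0 with sees-zero b≢0
      ... | x   , hi-last , _   = contradiction (last-≤ (proj₂ (∧-elim {hi} hi-last))) (ℕ.<⇒≱ j<i)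
      ... | y   , _       , y≡0 = contradiction refl (both-zero x≡0 y≡0)
      ... | a _ , _       , a≡0 = contradiction refl (both-zero x≡0 a≡0)

    -- The mirror image: x and the b's already see y, and y sees at most the first a.
    star-x : col y ≡ 0 → ∀ u v → H u v ≡ true → col u ≢ 0 → col v ≢ 0 → u ≡ x ⊎ v ≡ x
    star-x y≡0 = λ where
        y     v     _   u≢0 _   → contradiction y≡0 u≢0
        u     y     _   _   v≢0 → contradiction y≡0 v≢0
        x     v     _   _   _   → inj₁ refl
        u     x     _   _   _   → inj₂ refl
        (a i) (b j) j<i u≢0 _   → absurd {j = j} (<ᵇ⇒< j<i) u≢0
        (b i) (a j) i<j _   v≢0 → absurd {j = i} (<ᵇ⇒< i<j) v≢0
      where
      absurd : ∀ {i j} {A : Set} → toℕ j < toℕ i → col (a i) ≢ 0 → A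
      absurd {i} {j} j<i a≢0 with sees-zero a≢0
      ... | y   , lo-first , _   = contradiction (first-≤ (proj₂ (∧-elim {lo} lo-first))) (ℕ.<⇒≱ j<i)
      ... | x   , _        , x≡0 = contradiction refl (both-zero x≡0 y≡0)
      ... | b _ , _        , b≡0 = contradiction refl (both-zero b≡0 y≡0)

    module _ (x≢0 : col x ≢ 0) (y≢0 : col y ≢ 0) where

      a-sees : ∀ {i} → col (a i) ≢ 0 → ∃[ j ] (toℕ j < toℕ i × col (b j) ≡ 0)
      a-sees a≢0 with sees-zero a≢0
      ... | x   , _   , x≡0 = contradiction x≡0 x≢0
      ... | y   , _   , y≡0 = contradiction y≡0 y≢0
      ... | b j , j<i , b≡0 = j , <ᵇ⇒< j<i , b≡0

      b-sees : ∀ {i} → col (b i) ≢ 0 → ∃[ j ] (toℕ i < toℕ j × col (a j) ≡ 0)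
      b-sees b≢0 with sees-zero b≢0
      ... | x   , _   , x≡0 = contradiction x≡0 x≢0
      ... | y   , _   , y≡0 = contradiction y≡0 y≢0
      ... | a j , i<j , a≡0 = j , <ᵇ⇒< i<j , a≡0

      not-first : ∀ {i} {A : Set} → lo ∧ first i ≡ true → col (a i) ≢ 0 → A
      not-first lo-first a≢0 = let _ , j<i , _ = a-sees a≢0 in
        contradiction (first-≤ (proj₂ (∧-elim {lo} lo-first))) (ℕ.<⇒≱ j<i)

      not-last : ∀ {i} {A : Set} → hi ∧ last i ≡ true → col (b i) ≢ 0 → A
      not-last hi-last b≢0 = let _ , i<j , _ = b-sees b≢0 in
        contradiction (last-≤ (proj₂ (∧-elim {hi} hi-last))) (ℕ.<⇒≱ i<j)

      -- Only the two extra edges stay within a side, and they end in the first a or the last b. A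
      -- positive a i has a neighbour b j of colour 0 with j < i, so it is not first; dually for a
      -- positive b.
      crossing : ∀ u v → H u v ≡ true → col u ≢ 0 → col v ≢ 0 → xSide u ≡ not (xSide v)
      crossing x     y     _  _   _   = refl
      crossing x     (a _) _  _   _   = refl
      crossing x     (b i) e  _   v≢0 = not-last {i} e v≢0
      crossing y     x     _  _   _   = refl
      crossing y     (a i) e  _   v≢0 = not-first {i} e v≢0
      crossing y     (b _) _  _   _   = refl
      crossing (a _) x     _  _   _   = refl
      crossing (a i) y     e  u≢0 _   = not-first {i} e u≢0
      crossing (a _) (b _) _  _   _   = refl
      crossing (b i) x     e  u≢0 _   = not-last {i} e u≢0
      crossing (b _) y     _  _   _   = refl
      crossing (b _) (a _) _  _   _   = refl

      -- b j has a neighbour a k and a i a neighbour b l of colour 0, and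
      -- a k ≁ b l, so j < k ≤ l < i.
      a~b : ∀ {i j} → col (a i) ≢ 0 → col (b j) ≢ 0 → (toℕ j <ᵇ toℕ i) ≡ true
      a~b a≢0 b≢0 =
        let l , l<i , b≡0 = a-sees a≢0
            k , j<k , a≡0 = b-sees b≢0
            k≤l = ℕ.≮⇒≥ λ l<k → both-zero a≡0 b≡0 (<⇒<ᵇ l<k)
        in <⇒<ᵇ (ℕ.<-trans (ℕ.<-≤-trans j<k k≤l) l<i)

      joining : ∀ u v → xSide u ≡ not (xSide v) → col u ≢ 0 → col v ≢ 0 → H u v ≡ true
      joining x     y     _ _   _   = refl
      joining x     (a _) _ _   _   = refl
      joining y     x     _ _   _   = refl
      joining y     (b _) _ _   _   = refl
      joining (a _) x     _ _   _   = refl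
      joining (a _) (b _) _ u≢0 v≢0 = a~b u≢0 v≢0
      joining (b _) y     _ _   _   = refl
      joining (b _) (a _) _ u≢0 v≢0 = a~b v≢0 u≢0

    no-colour-3 : ∀ r → col r ≢ 3
    no-colour-3 r r≡3 =
      let u₂ , r~u₂ , u₂≡2 = sees {r} 2 (subst (2 <_) (≡-sym r≡3) ℕ.≤-refl)
          u₁ , r~u₁ , u₁≡1 = sees {r} 1 (subst (1 <_) (≡-sym r≡3) (s≤s (s≤s z≤n)))
          w₁ , u₂~w₁ , w₁≡1 = sees {u₂} 1 (subst (1 <_) (≡-sym u₂≡2) ℕ.≤-refl)
      in conclude r≡3 u₂≡2 u₁≡1 w₁≡1 r~u₂ r~u₁ u₂~w₁ (col x ℕ.≟ 0) (col y ℕ.≟ 0)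
      where
      conclude : ∀ {u₂ u₁ w₁} → col r ≡ 3 → col u₂ ≡ 2 → col u₁ ≡ 1 → col w₁ ≡ 1 →
                 H r u₂ ≡ true → H r u₁ ≡ true → H u₂ w₁ ≡ true →
                 Dec (col x ≡ 0) → Dec (col y ≡ 0) → ⊥
      conclude p q s t e f g (yes x≡0) _ = not-star p q s t e f g y (star-y x≡0)
      conclude p q s t e f g (no _) (yes y≡0) = not-star p q s t e f g x (star-x y≡0)
      conclude p q s t e f g (no x≢0) (no y≢0) =
        not-complete-bipartite p q s t e f g (crossing x≢0 y≢0) (joining x≢0 y≢0)

  H-bounded : ∀ {k} → HasGrundyColoring (labGraph H-system) k → k ≤ 3
  H-bounded {k} (c , proper , surjective , dominated) with k ≤? 3
  ... | yes k≤3 = k≤3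
  ... | no k≰3 = contradiction r≡3 (Bounded.no-colour-3 col col-proper col-sees (decode r))
    where
    3<k : 3 < k
    3<k = ℕ.≰⇒> k≰3
    col : Lab m → ℕ
    col u = toℕ (c (encode u))
    adj : ∀ {u v} → H u v ≡ true → Adj (labGraph H-system) (encode u) (encode v)
    adj {u} {v} u~v = trans (cong₂ H (decode-encode u) (decode-encode v)) u~v
    col-proper : ∀ {u v} → H u v ≡ true → col u ≢ col v
    col-proper {u} {v} u~v eq = proper (encode u) (encode v) (adj {u} {v} u~v) (Fin.toℕ-injective eq)
    col-sees : ∀ {v} i → i < col v → ∃[ u ] (H v u ≡ true × col u ≡ i)
    col-sees {v} i i<col =
      let i<k = ℕ.<-trans i<col (Fin.toℕ<n (c (encode v)))
          u , v~u , cu = dominated (encode v) (fromℕ< i<k) (subst (_< col v) (≡-sym (Fin.toℕ-fromℕ< i<k)) i<col)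
      in decode u , subst (λ v → H v (decode u) ≡ true) (decode-encode v) v~u ,
         trans (cong (toℕ ∘ c) (encode-decode {m} u)) (trans (cong toℕ cu) (Fin.toℕ-fromℕ< i<k))
    r = proj₁ (surjective (fromℕ< 3<k))
    r≡3 : col (decode r) ≡ 3
    r≡3 = trans (cong (toℕ ∘ c) (encode-decode {m} r))
            (trans (cong toℕ (proj₂ (surjective (fromℕ< 3<k)))) (Fin.toℕ-fromℕ< 3<k))

-- The extra edge from y to the first a closes the triangle, hence the value `true` for `lo` and the
-- successor in the index.
half-suitable : ∀ m hi → Suitable (half (suc m) true hi)
half-suitable m hi = record
  { system = H-system ; linked = H-linked ; bounded = H-bounded
  ; triangle = a zero , x , y , refl , first-zero , refl }
  where open Half (suc m) true hi

-- Pairwise non-isomorphism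

-- Without the square this would count walks of length k from v; squaring makes the invariant
-- nonlinear. Depth 3 is enough for both finite catalogues, as the evaluations below confirm.
weight : (G : Graph) → ℕ → Fin (n G) → ℕ
weight G zero    v = 1
weight G (suc k) v = let s = Sum.sum λ w → if E G v w then weight G k w else 0 in s * s

signature : Graph → ℕ
signature G = Sum.sum (weight G 3)

sum-≅ : ∀ {G H} (iso : G ≅ H) (f : Fin (n H) → ℕ) → Sum.sum f ≡ Sum.sum (f ∘ _≅_.to iso)
sum-≅ iso f = Sum.sum-permute f (permutation to from to-from from-to)
  where open _≅_ iso

weight-≅ : ∀ {G H} (iso : G ≅ H) k v → weight H k (_≅_.to iso v) ≡ weight G k v
weight-≅ iso zero    v = refl
weight-≅ {G} {H} iso (suc k) v = cong (λ s → s * s) (trans (sum-≅ {G} {H} iso _) (Sum.sum-cong-≗ summand))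
  where
  open _≅_ iso
  summand : ∀ w → (if E H (to v) (to w) then weight H k (to w) else 0) ≡ (if E G v w then weight G k w else 0)
  summand w rewrite preserve v w | weight-≅ {G} {H} iso k w = refl

signature-≅ : ∀ {G H} → G ≅ H → signature H ≡ signature G
signature-≅ {G} {H} iso = trans (sum-≅ {G} {H} iso _) (Sum.sum-cong-≗ (weight-≅ {G} {H} iso 3))

distinctSignatures : ∀ {k} → (Fin k → Graph) → Bool
distinctSignatures {k} G = allᵇ {k} λ i → allᵇ {k} λ j → i ≡ᶠ j ∨ not (signature (G i) ≡ᵇ signature (G j))

distinct⇒≇ : ∀ {k} {G : Fin k → Graph} → distinctSignatures G ≡ true → ∀ i j → i ≢ j → ¬ (G i ≅ G j)
distinct⇒≇ {G = G} eq i j i≢j iso with ∨-elim {i ≡ᶠ j} (allᵇ-sound (allᵇ-sound eq i) j)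
... | inj₁ i≡j = i≢j (≡ᶠ-sound i≡j)
... | inj₂ differ with signature (G i) ≡ᵇ signature (G j)
                     | ℕ.≡⇒≡ᵇ _ _ (≡-sym (signature-≅ {G i} {G j} iso))
...   | true | _ = contradiction differ λ ()

catalogue₃ : Vec (Lab 3 → Lab 3 → Bool) 3
catalogue₃ = half 3 true false ∷ half 3 true true ∷ sporadic₃ ∷ []

catalogue₃-suitable : ∀ i → Suitable (lookup catalogue₃ i)
catalogue₃-suitable zero             = half-suitable 2 false
catalogue₃-suitable (suc zero)       = half-suitable 2 true
catalogue₃-suitable (suc (suc zero)) = sporadic₃-suitable

halves : ∀ m → Vec (Lab m → Lab m → Bool) 2
halves m = half m true false ∷ half m true true ∷ []

halves-suitable : ∀ m i → Suitable (lookup (halves (suc m)) i)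
halves-suitable m zero       = half-suitable m false
halves-suitable m (suc zero) = half-suitable m true

opaque
  unfolding allLab

  catalogue₂-distinct : distinctSignatures (Suitable.graph ∘ catalogue₂-suitable) ≡ true
  catalogue₂-distinct = refl

  catalogue₃-distinct : distinctSignatures (Suitable.graph ∘ catalogue₃-suitable) ≡ true
  catalogue₃-distinct = refl

-- Signatures can be evaluated only for fixed m. For all m at once the two half graphs are told
-- apart by the last b, whose only neighbour is y when `hi` is false.
HasLeaf : Graph → Set
HasLeaf G = ∃[ v ] ∀ u w → Adj G v u → Adj G v w → u ≡ w

hasLeaf-≅ : ∀ {G H} → G ≅ H → HasLeaf G → HasLeaf H
hasLeaf-≅ {G} {H} iso (v , leaf) = to v , λ u w v~u v~w →
  trans (≡-sym (to-from u)) (trans (cong to (leaf (from u) (from w) (pull v~u) (pull v~w))) (to-from w))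
  where
  open _≅_ iso
  pull : ∀ {u} → Adj H (to v) u → Adj G v (from u)
  pull {u} v~u = trans (≡-sym (preserve v (from u))) (trans (cong (E H (to v)) (to-from u)) v~u)

hasLeaf-≅⁻ : ∀ {G H} → G ≅ H → HasLeaf H → HasLeaf G
hasLeaf-≅⁻ {G} {H} iso = hasLeaf-≅ {H} {G} record
  { to = from ; from = to ; from-to = to-from ; to-from = from-to
  ; preserve = λ u v → trans (≡-sym (preserve (from u) (from v))) (cong₂ (E H) (to-from u) (to-from v)) }
  where open _≅_ iso

last-leaf : ∀ m → HasLeaf (Suitable.graph (half-suitable m false))
last-leaf m = encode (b (fromℕ m)) , λ u w v~u v~w → decode-injective {suc m} 
  (trans (only-y (decode u) (at {u} v~u)) (≡-sym (only-y (decode w) (at {w} v~w))))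
  where
  H = half (suc m) true false
  at : ∀ {u} → H (decode (encode (b (fromℕ m)))) (decode u) ≡ true → H (b (fromℕ m)) (decode u) ≡ true
  at {u} = subst (λ v → H v (decode u) ≡ true) (decode-encode (b (fromℕ m)))
  only-y : ∀ u → H (b (fromℕ m)) u ≡ true → u ≡ y
  only-y y     _   = refl
  only-y (a i) m<i = contradiction (last-≤ {j = i} (last-fromℕ m)) (ℕ.<⇒≱ (<ᵇ⇒< m<i))

-- The two extra edges supply the second neighbour of the first a and of the last b.
no-leaf : ∀ m → ¬ HasLeaf (Suitable.graph (half-suitable m true))
no-leaf m (v , leaf) = two-neighbours (decode v) λ u w v~u v~w →
    trans (≡-sym (decode-encode u)) (trans (cong decode (leaf (encode u) (encode w) (at v~u) (at v~w))) (decode-encode w))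
  where
  H = half (suc m) true true
  at : ∀ {u} → H (decode v) u ≡ true → H (decode v) (decode (encode u)) ≡ true
  at {u} = subst (λ u → H (decode v) u ≡ true) (≡-sym (decode-encode u))
  two-neighbours : ∀ v → ¬ (∀ u w → H v u ≡ true → H v w ≡ true → u ≡ w)
  two-neighbours x only with only y (a zero) refl refl
  ... | ()
  two-neighbours y only with only x (b zero) refl refl
  ... | ()
  two-neighbours (a zero) only with only x y refl first-zero
  ... | ()
  two-neighbours (a (suc i)) only with only x (b zero) refl refl
  ... | ()
  two-neighbours (b i) only with ℕ.m≤n⇒m<n∨m≡n (ℕ.≤-pred (Fin.toℕ<n i))
  ... | inj₁ i<m with only y (a (fromℕ m)) refl (<⇒<ᵇ (subst (toℕ i <_) (≡-sym (Fin.toℕ-fromℕ m)) i<m))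
  ...   | ()
  two-neighbours (b i) only | inj₂ i≡m with only y x refl (subst (λ i → last i ≡ true)
      (Fin.toℕ-injective (trans (Fin.toℕ-fromℕ m) (≡-sym i≡m))) (last-fromℕ m))
  ... | ()

halves-≇ : ∀ m i j → i ≢ j → ¬ (Suitable.graph (halves-suitable m i) ≅ Suitable.graph (halves-suitable m j))
halves-≇ m zero       zero       i≢j _   = i≢j refl
halves-≇ m zero       (suc zero) _   iso = no-leaf m (hasLeaf-≅ iso (last-leaf m))
halves-≇ m (suc zero) zero       _   iso = no-leaf m (hasLeaf-≅⁻ iso (last-leaf m))
halves-≇ m (suc zero) (suc zero) i≢j _   = i≢j refl

-- Assembling the theorem

some-admissible : ∀ {m} → 2 ≤ m → Σ Graph λ G → Admissible (2 + m) G × n G ≡ 2 + (m + m)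
some-admissible {suc m} 2≤ = Suitable.graph (half-suitable m true) , suitable⇒admissible 2≤ (half-suitable m true) , refl

module _ {m : ℕ} (2≤m : 2 ≤ m) where

  admissible⇒no-atom : ∀ {G} → Admissible (2 + m) G → ¬ Atom (E G)
  admissible⇒no-atom {G} (_ , _ , (_ , Γ≤3) , _) A =
    let k , 3<k , grundy = Greedy.atom⇒grundy G A in contradiction (Γ≤3 k grundy) (ℕ.<⇒≱ 3<k)

  admissible-size : ∀ {G} → Admissible (2 + m) G → 2 + (m + m) ≤ n G
  admissible-size {G} adm@(_ , _ , _ , coloring , _) =
    complete-size {G} (admissible⇒no-atom {G} adm) 2≤m coloring

  suitable⇒extremal : {M : Lab m → Lab m → Bool} (U : Suitable M) → Extremal (2 + m) (Suitable.graph U)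
  suitable⇒extremal U = suitable⇒admissible 2≤m U , λ H → admissible-size {H}

  extremal⇒normal : ∀ {G} → Extremal (2 + m) G → Σ (Lab m → Lab m → Bool) λ M → Normal M × G ≃ M
  extremal⇒normal {G} (adm@(_ , _ , _ , coloring , _) , minimal) =
    let M , G≃M , sys = Classes.system G (admissible⇒no-atom {G} adm) 2≤m coloring size
        σ , σ-inj , N = normalise sys
    in _ , N , ≃-relabel {G = G} σ σ-inj G≃M
    where
    size : n G ≡ 2 + (m + m)
    -- The half graph with both extra edges attains the counting bound, so a minimal graph attains
    -- it too.
    size = let H , H-adm , H-size = some-admissible 2≤m in
      ℕ.≤-antisym (subst (n G ≤_) H-size (minimal H H-adm)) (admissible-size {G} adm)

  exactly : ∀ {k} (Ms : Vec (Lab m → Lab m → Bool) k) (U : ∀ i → Suitable (lookup Ms i)) →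
    (∀ i j → i ≢ j → ¬ (Suitable.graph (U i) ≅ Suitable.graph (U j))) →
    (∀ {G} → Connected G → ¬ HasProperColoring G 2 → ¬ Atom (E G) →
       ∀ {M} → Normal M → G ≃ M → ∃[ i ] G ≃ lookup Ms i) →
    ExactlyExtremalUpToIso (2 + m) k
  exactly Ms U distinct classify = tabulate graphs ,
    (λ i → subst (Extremal (2 + m)) (≡-sym (at i)) (suitable⇒extremal (U i))) ,
    (λ i j i≢j iso → distinct i j i≢j (subst₂ _≅_ (at i) (at j) iso)) ,
    λ G ext@(adm@(connected , (_ , χ≥3) , _) , _) →
      let M , N , G≃M = extremal⇒normal {G} ext
          i , G≃ = classify {G} connected (λ two → ℕ.<⇒≱ (ℕ.n<1+n 2) (χ≥3 2 two)) (admissible⇒no-atom {G} adm) N G≃M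
      in i , subst (G ≅_) (≡-sym (at i)) (≃⇒≅ {G = G} (Suitable.system (U i)) G≃)
    where
    graphs = Suitable.graph ∘ U
    at = lookup∘tabulate graphs

theorem3 : (h : ℕ) → 4 ≤ h →
    -- the minimum number of vertices is 2h-2
    (Σ Graph (λ G → Admissible h G × n G ≡ 2 * h ∸ 2) × (∀ G → Admissible h G → 2 * h ∸ 2 ≤ n G)) ×
    (h ≡ 4 → ExactlyExtremalUpToIso h 7) ×
    (h ≡ 5 → ExactlyExtremalUpToIso h 3) ×
    (6 ≤ h → ExactlyExtremalUpToIso h 2)
theorem3 (suc (suc m)) (s≤s (s≤s 2≤m)) =
  ( (let G , adm , size-G = some-admissible 2≤m in G , adm , trans size-G (≡-sym size))
  , λ G adm → subst (_≤ n G) (≡-sym size) (admissible-size 2≤m {G} adm)) ,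
  (λ { refl → exactly 2≤m catalogue₂ catalogue₂-suitable (distinct⇒≇ catalogue₂-distinct)
       λ {G} connected not-2 noAtom → Classify.classify₂ G connected not-2 noAtom }) ,
  (λ { refl → exactly 2≤m catalogue₃ catalogue₃-suitable (distinct⇒≇ catalogue₃-distinct)
       λ {G} connected not-2 noAtom N G≃M → case₃ {G} (Classify.classify₃ G connected not-2 noAtom N G≃M) }) ,
  large
  where
  size : 2 * (2 + m) ∸ 2 ≡ 2 + (m + m)
  size = trans (cong (m +_) (cong (λ k → 2 + k) (ℕ.+-identityʳ m)))
           (trans (ℕ.+-suc m (suc m)) (cong suc (ℕ.+-suc m m)))
  case₃ : ∀ {G} → G ≃ half 3 true false ⊎ G ≃ half 3 true true ⊎ G ≃ sporadic₃ → ∃[ i ] G ≃ lookup catalogue₃ i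
  case₃ (inj₁ G≃)        = zero , G≃
  case₃ (inj₂ (inj₁ G≃)) = suc zero , G≃
  case₃ (inj₂ (inj₂ G≃)) = suc (suc zero) , G≃
  large : 6 ≤ 2 + m → ExactlyExtremalUpToIso (2 + m) 2
  -- The third successor is peeled off to expose m as `suc m′`, the form in which the half graphs
  -- are known to be suitable.
  large (s≤s (s≤s (s≤s {n = m′} 3≤m′))) =
    exactly 2≤m (halves m) (halves-suitable m′) (halves-≇ m′)
      λ {G} connected not-2 noAtom N G≃M →
        case₂ {G} (Classify.classify₄ G connected not-2 noAtom (s≤s 3≤m′) N G≃M)
    where
    case₂ : ∀ {G} → G ≃ half m true false ⊎ G ≃ half m true true → ∃[ i ] G ≃ lookup (halves m) i
    case₂ (inj₁ G≃) = zero , G≃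
    case₂ (inj₂ G≃) = suc zero , G≃
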